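{- Let $a,m$ be integers with $2\le a\le m-1$, let $\gamma=a\,1\,2\cdots(a-1)\,(a+1)\cdots m\in\mathcal S_m$ (that is, $a$ followed by the remaining elements of $\{1,\dots,m\}$ in increasing order), and let $B=B(t,x)=\sum_{n\ge 0}t^n\sum_{\sigma\in\mathcal S_n(132)}x^{\gamma\text{ -mch}(\sigma)}$. Then $$B=\frac{1+t^{m-1}B^{m-a}(x-1)(B-1)}{1-tB}.$$
   Context: $\mathcal S_n$ is the set of permutations of $\{1,\dots,n\}$ in one-line notation ($\mathcal S_0$ contains only the empty permutation, on which all statistics are $0$). For a word $w$ of distinct integers, $\mathrm{red}(w)$ replaces the $i$-th smallest letter by $i$. $\sigma\in\mathcal S_n$ avoids $\lambda\in\mathcal S_k$ (classical avoidance) if no (not necessarily contiguous) subsequence $\sigma_{i_1}\cdots\sigma_{i_k}$, $i_1<\dots<i_k$, has reduction $\lambda$; $\mathcal S_n(\lambda)$ is the set of such $\sigma$. $\gamma\text{ -mch}(\sigma)$ is the number of $i$ with $\mathrm{red}(\sigma_i\sigma_{i+1}\cdots\sigma_{i+k-1})=\gamma$ for $\gamma\in\mathcal S_k$. The identity is one of formal power series in $t$ over $\mathbb Q[x]$. -}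

module Defs where

open import Algebra.Bundles.Raw using (RawRing)
import Algebra.Definitions.RawMonoid as RawMonoidDefs
import Algebra.Definitions.RawSemiring as RawSemiringDefs
open import Data.Fin.Base using (toℕ)
open import Data.List.Base
  using (List; []; _∷_; [_]; length; map; filter; foldr; take; tails; upTo; cartesianProductWith)
open import Data.List.Properties using (≡-dec)
import Data.List.Relation.Binary.Sublist.Propositional as Sublist
open Sublist using (_⊆_)
import Data.List.Relation.Unary.Unique.DecPropositional as DecUnique
open import Data.Nat.Base as ℕ using (ℕ; zero; suc; _∸_)
import Data.Nat.Properties as ℕ
open import Data.Product.Base using (∃; _×_; _,_)
open import Data.Rational.Base as ℚ using (ℚ; 0ℚ; 1ℚ)
open import Data.Sum.Base using (inj₁; inj₂; [_,_]′)
open import Level using (Level; 0ℓ; _⊔_)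
open import Relation.Binary.Definitions using (DecidableEquality)
open import Relation.Binary.PropositionalEquality.Core using (_≡_; refl)
open import Relation.Nullary.Decidable using (Dec; map′; ¬?; _⊎-dec_)
open import Relation.Nullary.Negation.Core using (¬_)
open import Relation.Unary using (Pred; Decidable)

Word : Set
Word = List ℕ

infix 4 _≟ʷ_

_≟ʷ_ : DecidableEquality Word
_≟ʷ_ = ≡-dec ℕ._≟_

[1⋯_] : ℕ → Word
[1⋯ n ] = map suc (upTo n)

wordsOver : Word → ℕ → List Word
wordsOver A zero    = [ [] ]
wordsOver A (suc n) = cartesianProductWith _∷_ A (wordsOver A n)

-- Permutations in one-line notation, with letters 1, …, n (not 0, …, n - 1):
-- a word of length n in these letters is a permutation precisely when
-- its letters are distinct; each such word is listed exactly once.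

𝒮 : ℕ → List Word
𝒮 n = filter (DecUnique.unique? ℕ._≟_) (wordsOver [1⋯ n ] n)

-- In a word of distinct letters, b is the i-th smallest letter precisely when
-- i letters are ≤ b.

red : Word → Word
red w = map (λ b → length (filter (ℕ._≤? b) w)) w

Contains : Word → Word → Set
Contains pat σ = ∃ λ τ → τ ⊆ σ × red τ ≡ pat

Avoids : Word → Word → Set
Avoids pat σ = ¬ Contains pat σ

∃⊆? : ∀ {p} {P : Pred Word p} → Decidable P →
      ∀ σ → Dec (∃ λ τ → τ ⊆ σ × P τ)
∃⊆? P? []      = map′ (λ p → [] , Sublist.[] , p)
                      (λ { (_ , Sublist.[] , p) → p })
                      (P? [])
∃⊆? P? (a ∷ σ) = map′
  [ (λ { (τ , s , p) → a ∷ τ , refl Sublist.∷ s , p })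
  , (λ { (τ , s , p) → τ , a Sublist.∷ʳ s , p }) ]′
  (λ { (_ , (refl Sublist.∷ s) , p) → inj₁ (_ , s , p)
     ; (τ , (_ Sublist.∷ʳ s) , p) → inj₂ (τ , s , p) })
  (∃⊆? (λ τ → P? (a ∷ τ)) σ ⊎-dec ∃⊆? P? σ)

avoids? : ∀ pat → Decidable (Avoids pat)
avoids? pat σ = ¬? (∃⊆? (λ τ → red τ ≟ʷ pat) σ)

𝒮[_] : Word → ℕ → List Word
𝒮[ pat ] n = filter (avoids? pat) (𝒮 n)

-- The suffixes of σ correspond to the starting positions of its factors.  As
-- `red` preserves length, suffixes shorter than pat never contribute.

mch : Word → Word → ℕ
mch pat σ = length (filter (λ τ → red (take (length pat) τ) ≟ʷ pat) (tails σ))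

-- Coefficient lists, constant term first; trailing zeros are permitted, and
-- are identified by the equality.

module Polynomial where

  Poly : Set
  Poly = List ℚ

  coeff : Poly → ℕ → ℚ
  coeff []      k       = 0ℚ
  coeff (a ∷ p) zero    = a
  coeff (a ∷ p) (suc k) = coeff p k

  infix  8 -_
  infixl 7 _*_
  infixl 6 _+_
  infix  4 _≈_

  _≈_ : Poly → Poly → Set
  p ≈ q = ∀ k → coeff p k ≡ coeff q k

  _+_ : Poly → Poly → Poly
  []      + q       = q
  (a ∷ p) + []      = a ∷ p
  (a ∷ p) + (b ∷ q) = (a ℚ.+ b) ∷ (p + q)

  -_ : Poly → Poly
  - p = map ℚ.-_ p

  _*_ : Poly → Poly → Poly
  []      * q = []
  (a ∷ p) * q = map (a ℚ.*_) q + (0ℚ ∷ (p * q))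

  X : Poly
  X = 0ℚ ∷ 1ℚ ∷ []

  rawRing : RawRing 0ℓ 0ℓ
  rawRing = record
    { Carrier = Poly
    ; _≈_     = _≈_
    ; _+_     = _+_
    ; _*_     = _*_
    ; -_      = -_
    ; 0#      = []
    ; 1#      = 1ℚ ∷ []
    }

  open RawSemiringDefs (RawRing.rawSemiring rawRing) public using (_^_)

ℚ[x] : RawRing 0ℓ 0ℓ
ℚ[x] = Polynomial.rawRing

module PowerSeries {c ℓ : Level} (R : RawRing c ℓ) where

  private module R = RawRing R

  Series : Set c
  Series = ℕ → R.Carrier

  infix  8 -_
  infixl 7 _*_
  infixl 6 _+_ _-_
  infix  4 _≈_ _≈_/_

  _≈_ : Series → Series → Set ℓ
  f ≈ g = ∀ n → f n R.≈ g n

  const : R.Carrier → Series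
  const a zero    = a
  const a (suc n) = R.0#

  t : Series
  t zero          = R.0#
  t (suc zero)    = R.1#
  t (suc (suc n)) = R.0#

  _+_ : Series → Series → Series
  (f + g) n = f n R.+ g n

  -_ : Series → Series
  (- f) n = R.- f n

  _-_ : Series → Series → Series
  f - g = f + (- g)

  _*_ : Series → Series → Series
  (f * g) n = RawMonoidDefs.sum R.+-rawMonoid {suc n}
                (λ i → f (toℕ i) R.* g (n ∸ toℕ i))

  0# 1# : Series
  0# = const R.0#
  1# = const R.1#

  rawRing : RawRing c ℓ
  rawRing = record
    { Carrier = Series
    ; _≈_     = _≈_
    ; _+_     = _+_
    ; _*_     = _*_
    ; -_      = -_
    ; 0#      = 0#
    ; 1#      = 1#
    }

  open RawSemiringDefs (RawRing.rawSemiring rawRing) public using (_^_)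

  -- f ≈ g / h : the series h is invertible, and f is g times its inverse.

  _≈_/_ : Series → Series → Series → Set (c ⊔ ℓ)
  f ≈ g / h = ∃ λ h⁻¹ → h * h⁻¹ ≈ 1# × f ≈ g * h⁻¹

module ℚ[x]⟦t⟧ where

  open PowerSeries ℚ[x] public

  x : Series
  x = const Polynomial.X

γ : ℕ → ℕ → Word
γ a m = a ∷ filter (λ b → ¬? (b ℕ.≟ a)) [1⋯ m ]

B : Word → ℚ[x]⟦t⟧.Series
B pat n = foldr _+_ [] (map (λ σ → X ^ mch pat σ) (𝒮[ 1 ∷ 3 ∷ 2 ∷ [] ] n))
  where open Polynomial using (_+_; _^_; X)

{-# OPTIONS --safe #-}
module Submission where

-- A 132-avoiding permutation is empty or of the form L N R, where N is its
-- largest letter, L and R avoid 132 and every letter of L exceeds every letter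
-- of R; so these permutations correspond to binary trees.  As the last letter
-- of γ = γ a m is its largest, an occurrence of γ in L N R lies in L, lies in R,
-- or ends at N; in the last case L ends in an occurrence of γ a (m - 1).  Let E_d
-- be the part of B due to the permutations ending in an occurrence of γ a (a + d),
-- put D = m - 1 - a and B′ = B + (x - 1) E_D.  The same analysis of L N R gives
--   B = 1 + t B′ B,   E_0 = t B′ t^(a-1) + t B′ E_0,   E_(d+1) = t E_d + t B′ E_(d+1),
-- and as 1 - t B′ is the inverse of B, E_0 = t^(a-1) (B - 1) and E_(d+1) = t B E_d.
-- Substituting E_D into the first equation gives the theorem.

open import Defs
open import Algebra.Bundles using (CommutativeRing)
import Algebra.Morphism.RingMonomorphism as RingMonomorphism
import Algebra.Solver.Ring.NaturalCoefficients.Default as RingSolver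
open import Algebra.Structures using (IsCommutativeRing)
open import Data.Bool.Base using (true; false; if_then_else_)
open import Data.Empty using (⊥)
open import Data.Fin.Base using (Fin; toℕ; fromℕ<)
import Data.Fin.Properties as Fin
open import Data.List.Base using
  (List; []; _∷_; [_]; _++_; _∷ʳ_; map; foldr; filter; length; take; tails; upTo; concat;
   tabulate; cartesianProductWith; initLast; _∷ʳ′_)
import Data.List.Properties as List
open import Data.List.Membership.Propositional using (_∈_; _∉_)
import Data.List.Membership.Propositional.Properties as ∈
open import Data.List.Membership.Propositional.Properties.WithK using (unique∧set⇒bag)
open import Data.List.Relation.Binary.BagAndSetEquality using (∼bag⇒↭)
open import Data.List.Relation.Binary.Permutation.Propositional as ↭ using (_↭_)
import Data.List.Relation.Binary.Permutation.Propositional.Properties as ↭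
open import Data.List.Relation.Binary.Sublist.Propositional as Sublist
  using (_⊆_; []; _∷_; from∈; lookup)
import Data.List.Relation.Binary.Sublist.Propositional.Properties as ⊆
open import Data.List.Relation.Unary.All as All using (All; []; _∷_)
import Data.List.Relation.Unary.All.Properties as AllP
open import Data.List.Relation.Unary.AllPairs using (AllPairs; []; _∷_)
import Data.List.Relation.Unary.AllPairs.Properties as AllPairs
open import Data.List.Relation.Unary.Any as Any using (here; there)
open import Data.List.Relation.Unary.Unique.Propositional using (Unique)
import Data.List.Relation.Unary.Unique.Propositional.Properties as Unique
open import Data.Nat.Base as ℕ using (ℕ; zero; suc; z≤n; s≤s; _≤_; _<_; _∸_)
import Data.Nat.Properties as ℕ
open import Data.Product.Base using (∃; ∃₂; _×_; _,_; proj₁; proj₂)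
open import Data.Rational.Base as ℚ using (0ℚ)
import Data.Rational.Properties as ℚ
open import Data.Sum.Base using (_⊎_; inj₁; inj₂; [_,_]′)
open import Function.Base using (_∘_)
open import Function.Bundles using (mk⇔)
open import Level using (Level; 0ℓ)
open import Relation.Binary.Core using (Rel)
open import Relation.Binary.Definitions using (tri<; tri≈; tri>)
open import Relation.Binary.PropositionalEquality as ≡
  using (_≡_; _≢_; refl; module ≡-Reasoning)
import Relation.Binary.Reasoning.Setoid as SetoidReasoning
open import Relation.Nullary.Decidable using (Dec; yes; no; does; dec-false; ¬?)
open import Relation.Nullary.Negation using (¬_; contradiction)
open import Relation.Unary using (Pred; Decidable)

-- The equations for E_d concern weights as well as shapes. Appending N to an L that ends in γ a (a
-- + d) creates a new match exactly when L also ends in γ a (a + D), so the term t E_d is right only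
-- if, for d < D, L cannot do both. It cannot: without its last d letters, L would end in a copy of
-- a 1 ⋯ (a - 1) and also in a longer factor whose last letter is its largest, whereas for a ≥ 2 the
-- last letter of the copy is smaller than its first. This is where 2 ≤ a enters. Similarly, the
-- factor t^(a-1) in the equation for E_0 stands for an increasing R of a - 1 letters, which has
-- weight 1 because it is too short to contain a match. On trees the statistics become structural
-- recursions that do not mention letters, since reductions do not see how far L is shifted above R.
-- The quotient in the theorem asks for an actual inverse of 1 - t B; it is obtained
-- combinatorially, as the generating function of a second weight on trees.

-- The commutative ring of formal power series.

module PowerSeriesRing {c ℓ} (R : CommutativeRing c ℓ) where

  private module R = CommutativeRing R
  open R using (_≈_)
  module S = PowerSeries R.rawRing
  open S using (Series; _+_; _*_; -_; const; 0#; 1#; t)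
  open SetoidReasoning R.setoid
  open import Algebra.Properties.CommutativeSemigroup
    R.+-commutativeSemigroup using (interchange)

  open import Algebra.Properties.Semiring.Sum R.semiring using (sum-cong-≋)

  -- The sum that defines a product unfolds by computation: coefficient `suc n` of `f * g` is
  -- `f 0 R.* g (suc n)` plus coefficient `n` of `tail f * g`. Hence the ring laws follow by
  -- induction on the coefficient, passing from `f` to `tail f`.
  tail : Series → Series
  tail f n = f (suc n)

  infixl 7 _·_
  _·_ : R.Carrier → Series → Series
  (a · f) n = a R.* f n

  *-cong : ∀ {f f′ g g′} → f S.≈ f′ → g S.≈ g′ → f * g S.≈ f′ * g′
  *-cong p q n = sum-cong-≋ {suc n} (λ i → R.*-cong (p (toℕ i)) (q (n ℕ.∸ toℕ i)))

  *-zeroˡ : ∀ {z} → (∀ n → z n ≈ R.0#) → ∀ f n → (z * f) n ≈ R.0#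
  *-zeroˡ z≈0 f zero = R.trans (R.+-identityʳ _) (R.trans (R.*-congʳ (z≈0 0)) (R.zeroˡ _))
  *-zeroˡ z≈0 f (suc n) = R.trans
    (R.+-cong (R.trans (R.*-congʳ (z≈0 0)) (R.zeroˡ _)) (*-zeroˡ (λ k → z≈0 (suc k)) f n))
    (R.+-identityʳ _)

  const-* : ∀ a f → const a * f S.≈ a · f
  const-* a f zero    = R.+-identityʳ _
  const-* a f (suc n) =
    R.trans (R.+-congˡ (*-zeroˡ (λ _ → R.refl) f n)) (R.+-identityʳ _)

  *-distribʳ : ∀ h f g → (f + g) * h S.≈ f * h + g * h
  *-distribʳ h f g zero = begin
    (f 0 R.+ g 0) R.* h 0 R.+ R.0#                ≈⟨ R.+-identityʳ _ ⟩
    (f 0 R.+ g 0) R.* h 0                         ≈⟨ R.distribʳ _ _ _ ⟩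
    f 0 R.* h 0 R.+ g 0 R.* h 0                   ≈⟨ R.+-cong (R.+-identityʳ _) (R.+-identityʳ _) ⟨
    (f 0 R.* h 0 R.+ R.0#) R.+ (g 0 R.* h 0 R.+ R.0#)  ∎
  *-distribʳ h f g (suc n) = begin
    (f 0 R.+ g 0) R.* h (suc n) R.+ ((tail f + tail g) * h) n
      ≈⟨ R.+-cong (R.distribʳ _ _ _) (*-distribʳ h (tail f) (tail g) n) ⟩
    (f 0 R.* h (suc n) R.+ g 0 R.* h (suc n)) R.+ ((tail f * h) n R.+ (tail g * h) n)
      ≈⟨ interchange _ _ _ _ ⟩
    (f * h) (suc n) R.+ (g * h) (suc n) ∎

  ·-* : ∀ a f g → (a · f) * g S.≈ a · (f * g)
  ·-* a f g zero = begin
    a R.* f 0 R.* g 0 R.+ R.0#     ≈⟨ R.+-identityʳ _ ⟩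
    a R.* f 0 R.* g 0              ≈⟨ R.*-assoc _ _ _ ⟩
    a R.* (f 0 R.* g 0)            ≈⟨ R.*-congˡ (R.+-identityʳ _) ⟨
    a R.* (f 0 R.* g 0 R.+ R.0#)   ∎
  ·-* a f g (suc n) = begin
    a R.* f 0 R.* g (suc n) R.+ ((a · tail f) * g) n
      ≈⟨ R.+-cong (R.*-assoc _ _ _) (·-* a (tail f) g n) ⟩
    a R.* (f 0 R.* g (suc n)) R.+ a R.* (tail f * g) n
      ≈⟨ R.distribˡ _ _ _ ⟨
    a R.* (f * g) (suc n) ∎

  *-assoc : ∀ f g h → (f * g) * h S.≈ f * (g * h)
  *-assoc f g h zero = begin
    (f 0 R.* g 0 R.+ R.0#) R.* h 0 R.+ R.0#  ≈⟨ R.+-congʳ (R.*-congʳ (R.+-identityʳ _)) ⟩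
    f 0 R.* g 0 R.* h 0 R.+ R.0#             ≈⟨ R.+-congʳ (R.*-assoc _ _ _) ⟩
    f 0 R.* (g 0 R.* h 0) R.+ R.0#           ≈⟨ R.+-congʳ (R.*-congˡ (R.+-identityʳ _)) ⟨
    f 0 R.* (g 0 R.* h 0 R.+ R.0#) R.+ R.0#  ∎
  *-assoc f g h (suc n) = begin
    -- The tail of `f * g` is `(f 0 · tail g) + tail f * g`, so distributivity and scaling reduce
    -- the claim to the one for `tail f`.
    (f 0 R.* g 0 R.+ R.0#) R.* h (suc n) R.+ (((f 0 · tail g) + tail f * g) * h) n
      ≈⟨ R.+-cong (R.trans (R.*-congʳ (R.+-identityʳ _)) (R.*-assoc _ _ _))
                  (*-distribʳ h (f 0 · tail g) (tail f * g) n) ⟩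
    f 0 R.* (g 0 R.* h (suc n)) R.+ (((f 0 · tail g) * h) n R.+ ((tail f * g) * h) n)
      ≈⟨ R.+-assoc _ _ _ ⟨
    f 0 R.* (g 0 R.* h (suc n)) R.+ ((f 0 · tail g) * h) n R.+ ((tail f * g) * h) n
      ≈⟨ R.+-cong (R.+-congˡ (·-* (f 0) (tail g) h n)) (*-assoc (tail f) g h n) ⟩
    f 0 R.* (g 0 R.* h (suc n)) R.+ f 0 R.* (tail g * h) n R.+ (tail f * (g * h)) n
      ≈⟨ R.+-congʳ (R.distribˡ _ _ _) ⟨
    (f * (g * h)) (suc n) ∎

  -- Products peel only their left factor; commutativity also needs the summand at the other end.
  *-last : ∀ f g n → (g * f) (suc n) ≈ (g * tail f) n R.+ g (suc n) R.* f 0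
  *-last f g zero    = R.trans (R.+-congˡ (R.+-identityʳ _)) (R.+-congʳ (R.sym (R.+-identityʳ _)))
  *-last f g (suc n) = R.trans (R.+-congˡ (*-last f (tail g) n)) (R.sym (R.+-assoc _ _ _))

  *-comm : ∀ f g → f * g S.≈ g * f
  *-comm f g zero    = R.+-congʳ (R.*-comm _ _)
  *-comm f g (suc n) = begin
    f 0 R.* g (suc n) R.+ (tail f * g) n  ≈⟨ R.+-cong (R.*-comm _ _) (*-comm (tail f) g n) ⟩
    g (suc n) R.* f 0 R.+ (g * tail f) n  ≈⟨ R.+-comm _ _ ⟩
    (g * tail f) n R.+ g (suc n) R.* f 0  ≈⟨ *-last f g n ⟨
    (g * f) (suc n) ∎

  const-0# : ∀ n → 0# n ≈ R.0#
  const-0# zero    = R.refl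
  const-0# (suc n) = R.refl

  isCommutativeRing : IsCommutativeRing S._≈_ _+_ _*_ -_ 0# 1#
  isCommutativeRing = record
    { isRing = record
      { +-isAbelianGroup = record
        { isGroup = record
          { isMonoid = record
            { isSemigroup = record
              { isMagma = record
                { isEquivalence = record
                  { refl  = λ n → R.refl
                  ; sym   = λ p n → R.sym (p n)
                  ; trans = λ p q n → R.trans (p n) (q n)
                  }
                ; ∙-cong = λ p q n → R.+-cong (p n) (q n)
                }
              ; assoc = λ f g h n → R.+-assoc _ _ _
              }
            ; identity = (λ f n → R.trans (R.+-congʳ (const-0# n)) (R.+-identityˡ _))
                       , (λ f n → R.trans (R.+-congˡ (const-0# n)) (R.+-identityʳ _))
            }
          ; inverse = (λ f n → R.trans (R.-‿inverseˡ _) (R.sym (const-0# n)))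
                    , (λ f n → R.trans (R.-‿inverseʳ _) (R.sym (const-0# n)))
          ; ⁻¹-cong = λ p n → R.-‿cong (p n)
          }
        ; comm = λ f g n → R.+-comm _ _
        }
      ; *-cong = *-cong
      ; *-assoc = *-assoc
      ; *-identity = *-identityˡ , λ f n → R.trans (*-comm f 1# n) (*-identityˡ f n)
      ; distrib = (λ f g h n → R.trans (*-comm f (g + h) n)
                                 (R.trans (*-distribʳ f g h n) (R.+-cong (*-comm g f n) (*-comm h f n))))
                , *-distribʳ
      }
    ; *-comm = *-comm
    }
    where
    *-identityˡ : ∀ f → 1# * f S.≈ f
    *-identityˡ f n = R.trans (const-* R.1# f n) (R.*-identityˡ _)

  commutativeRing : CommutativeRing c ℓ
  commutativeRing = record { isCommutativeRing = isCommutativeRing }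

  t-*-suc : ∀ f n → (t * f) (suc n) ≈ f n
  t-*-suc f n = R.trans (R.+-cong (R.zeroˡ _) (tail-t n)) (R.+-identityˡ _)
    where
    tail-t : ∀ n → (tail t * f) n ≈ f n
    tail-t zero = R.trans (R.+-identityʳ _) (R.*-identityˡ _)
    tail-t (suc n) = R.trans (R.+-cong (R.*-identityˡ _) (*-zeroˡ (λ _ → R.refl) f n)) (R.+-identityʳ _)

  t-*-zero : ∀ f → (t * f) 0 ≈ R.0#
  t-*-zero f = R.trans (R.+-identityʳ _) (R.zeroˡ _)

-- The ring of polynomials inside the ring of power series.

module PolynomialRing where
  open Polynomial
  private
    module ℚ⟦x⟧ = PowerSeriesRing ℚ.+-*-commutativeRing
    module F = ℚ⟦x⟧.S

  coeff-+ : ∀ p q k → coeff (p + q) k ≡ coeff p k ℚ.+ coeff q k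
  coeff-+ []      q       k       = ≡.sym (ℚ.+-identityˡ _)
  coeff-+ (a ∷ p) []      k       = ≡.sym (ℚ.+-identityʳ _)
  coeff-+ (a ∷ p) (b ∷ q) zero    = ≡.refl
  coeff-+ (a ∷ p) (b ∷ q) (suc k) = coeff-+ p q k

  coeff-- : ∀ p k → coeff (- p) k ≡ ℚ.- coeff p k
  coeff-- []      k       = ≡.refl
  coeff-- (a ∷ p) zero    = ≡.refl
  coeff-- (a ∷ p) (suc k) = coeff-- p k

  coeff-map-* : ∀ a p k → coeff (map (a ℚ.*_) p) k ≡ a ℚ.* coeff p k
  coeff-map-* a []      k       = ≡.sym (ℚ.*-zeroʳ a)
  coeff-map-* a (b ∷ p) zero    = ≡.refl
  coeff-map-* a (b ∷ p) (suc k) = coeff-map-* a p k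

  coeff-* : ∀ p q k → coeff (p * q) k ≡ (coeff p F.* coeff q) k
  coeff-* []      q k = ≡.sym (ℚ⟦x⟧.*-zeroˡ (λ _ → ≡.refl) (coeff q) k)
  coeff-* (a ∷ p) q k = ≡.trans (coeff-+ (map (a ℚ.*_) q) (0ℚ ∷ (p * q)) k) (go k)
    where
    go : ∀ k → coeff (map (a ℚ.*_) q) k ℚ.+ coeff (0ℚ ∷ (p * q)) k ≡ (coeff (a ∷ p) F.* coeff q) k
    go zero    = ≡.cong (ℚ._+ 0ℚ) (coeff-map-* a q 0)
    go (suc k) = ≡.cong₂ ℚ._+_ (coeff-map-* a q (suc k)) (coeff-* p q k)

  -- Equality of polynomials is equality of coefficients, so `coeff` is an injective homomorphism
  -- into the power series over ℚ, and the ring laws are pulled back along it.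
  commutativeRing : CommutativeRing 0ℓ 0ℓ
  commutativeRing = record
    { isCommutativeRing = RingMonomorphism.isCommutativeRing
        {R₁ = rawRing} {R₂ = F.rawRing} {⟦_⟧ = coeff}
        record
          { isRingHomomorphism = record
            { isSemiringHomomorphism = record
              { isNearSemiringHomomorphism = record
                { +-isMonoidHomomorphism = record
                  { isMagmaHomomorphism = record
                    { isRelHomomorphism = record { cong = λ p → p }
                    ; homo = coeff-+
                    }
                  ; ε-homo = λ k → ≡.sym (ℚ⟦x⟧.const-0# k)
                  }
                ; *-homo = coeff-*
                }
              ; 1#-homo = λ { zero → ≡.refl ; (suc k) → ≡.refl }
              }
            ; -‿homo = coeff--
            }
          ; injective = λ p → p
          }
        ℚ⟦x⟧.isCommutativeRing
    }

-- Solving the functional equations in an arbitrary commutative ring.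

module KernelEquations {c ℓ} (R : CommutativeRing c ℓ) where

  open CommutativeRing R hiding (zero) renaming (refl to ≈-refl)
  open import Algebra.Properties.Semiring.Exp semiring using (_^_; ^-homo-*)
  open import Algebra.Properties.CommutativeSemiring.Exp commutativeSemiring using (^-distrib-*)
  open import Algebra.Properties.Group +-group using () renaming (∙-cancelʳ to +-cancelʳ)
  open import Algebra.Properties.Ring ring using (-‿distribˡ-*)
  open SetoidReasoning setoid
  open RingSolver commutativeSemiring using (solve; _:=_; _:+_; _:*_; con)

  -- 1 - t B′ is the inverse of B.

  kernel : ∀ {t B B′ E Z} → B ≈ 1# + t * (B′ * B) → E ≈ t * Z + t * (B′ * E) → E ≈ t * B * Z
  kernel {t} {B} {B′} {E} {Z} B-eq E-eq = +-cancelʳ (t * (B′ * B) * E) E (t * B * Z) (begin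
    E + t * (B′ * B) * E              ≈⟨ solve 2 (λ P E → E :+ P :* E := (con 1 :+ P) :* E) ≈-refl _ _ ⟩
    (1# + t * (B′ * B)) * E           ≈⟨ *-congʳ B-eq ⟨
    B * E                             ≈⟨ *-congˡ E-eq ⟩
    B * (t * Z + t * (B′ * E))        ≈⟨ solve 5 (λ t B B′ E Z →
      B :* (t :* Z :+ t :* (B′ :* E)) := t :* B :* Z :+ t :* (B′ :* B) :* E) ≈-refl t B B′ E Z ⟩
    t * B * Z + t * (B′ * B) * E      ∎)

  geometric : ∀ {t B G} → G ≈ 1# + t * (B * G) → (1# - t * B) * G ≈ 1#
  geometric {t} {B} {G} G-eq = begin
    (1# - t * B) * G                          ≈⟨ distribʳ G 1# (- (t * B)) ⟩
    1# * G + - (t * B) * G                    ≈⟨ +-cong (trans (*-identityˡ G) G-eq) (sym (-‿distribˡ-* (t * B) G)) ⟩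
    1# + t * (B * G) - t * B * G              ≈⟨ +-congˡ (-‿cong (*-assoc t B G)) ⟩
    1# + t * (B * G) - t * (B * G)            ≈⟨ +-assoc _ _ _ ⟩
    1# + (t * (B * G) - t * (B * G))          ≈⟨ +-congˡ (-‿inverseʳ _) ⟩
    1# + 0#                                   ≈⟨ +-identityʳ 1# ⟩
    1#                                        ∎

  module _ {t y B B′ : Carrier} (E : ℕ → Carrier) (k D : ℕ)
    (B′-eq : B′ ≈ B + y * E D)
    (B-eq  : B ≈ 1# + t * (B′ * B))
    (E₀-eq : E 0 ≈ t * (B′ * t ^ k) + t * (B′ * E 0))
    (E₊-eq : ∀ d → d ℕ.< D → E (suc d) ≈ t * E d + t * (B′ * E (suc d)))
    where

    -- By `kernel` each recurrence multiplies by `t * B`; at the base the remaining factor `B′` is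
    -- absorbed by `t * (B′ * B) ≈ B - 1#`.
    E-closed : ∀ d → d ℕ.≤ D → E d ≈ (t * B) ^ d * (t ^ k * (B - 1#))
    E-closed zero _ = begin
      E 0                       ≈⟨ kernel B-eq E₀-eq ⟩
      t * B * (B′ * t ^ k)      ≈⟨ solve 4 (λ t B B′ tᵏ →
        t :* B :* (B′ :* tᵏ) := con 1 :* (tᵏ :* (t :* (B′ :* B)))) ≈-refl t B B′ (t ^ k) ⟩
      1# * (t ^ k * (t * (B′ * B)))   ≈⟨ *-congˡ (*-congˡ B-1) ⟨
      1# * (t ^ k * (B - 1#))         ∎
      where
      B-1 : B - 1# ≈ t * (B′ * B)
      B-1 = begin
        B - 1#                        ≈⟨ +-congʳ B-eq ⟩
        1# + t * (B′ * B) - 1#        ≈⟨ +-congʳ (+-comm _ _) ⟩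
        t * (B′ * B) + 1# - 1#        ≈⟨ +-assoc _ _ _ ⟩
        t * (B′ * B) + (1# - 1#)      ≈⟨ +-congˡ (-‿inverseʳ 1#) ⟩
        t * (B′ * B) + 0#             ≈⟨ +-identityʳ _ ⟩
        t * (B′ * B)                  ∎
    E-closed (suc d) d<D = begin
      E (suc d)                                        ≈⟨ kernel B-eq (E₊-eq d d<D) ⟩
      t * B * E d                                      ≈⟨ *-congˡ (E-closed d (ℕ.<⇒≤ d<D)) ⟩
      t * B * ((t * B) ^ d * (t ^ k * (B - 1#)))       ≈⟨ *-assoc _ _ _ ⟨
      (t * B) ^ suc d * (t ^ k * (B - 1#))             ∎

    -- With `y` for x - 1, `k` for a - 1 and `D` for m - 1 - a, the exponents are m - 1 and m - a.
    -- It suffices to identify `B * (1# - t * B)` with the numerator; adding `t * B * B` to both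
    -- sides removes the subtraction, which the semiring solver can only treat as an atom.
    B-closed : ∀ {h⁻¹} → (1# - t * B) * h⁻¹ ≈ 1# →
      B ≈ (1# + t ^ (suc k ℕ.+ D) * B ^ suc D * y * (B - 1#)) * h⁻¹
    B-closed {h⁻¹} h-inv = begin
      B                                  ≈⟨ *-identityʳ B ⟨
      B * 1#                             ≈⟨ *-congˡ h-inv ⟨
      B * ((1# - t * B) * h⁻¹)           ≈⟨ *-assoc _ _ _ ⟨
      B * (1# - t * B) * h⁻¹             ≈⟨ *-congʳ (+-cancelʳ (t * B * B) _ _ numerator) ⟩
      (1# + t ^ (suc k ℕ.+ D) * B ^ suc D * y * (B - 1#)) * h⁻¹  ∎
      where
      powers : t ^ k * (t * B) ^ suc D ≈ t ^ (suc k ℕ.+ D) * B ^ suc D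
      powers = begin
        t ^ k * (t * B) ^ suc D           ≈⟨ *-congˡ (^-distrib-* t B (suc D)) ⟩
        t ^ k * (t ^ suc D * B ^ suc D)   ≈⟨ *-assoc _ _ _ ⟨
        t ^ k * t ^ suc D * B ^ suc D     ≈⟨ *-congʳ (^-homo-* t k (suc D)) ⟨
        t ^ (k ℕ.+ suc D) * B ^ suc D     ≡⟨ ≡.cong (λ e → t ^ e * B ^ suc D) (ℕ.+-suc k D) ⟩
        t ^ (suc k ℕ.+ D) * B ^ suc D     ∎
      numerator : B * (1# - t * B) + t * B * B
                ≈ 1# + t ^ (suc k ℕ.+ D) * B ^ suc D * y * (B - 1#) + t * B * B
      numerator = begin
        B * (1# - t * B) + t * B * B
          ≈⟨ solve 3 (λ B P N → B :* (con 1 :+ N) :+ P :* B := B :+ B :* (P :+ N)) ≈-refl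
               B (t * B) (- (t * B)) ⟩
        B + B * (t * B - t * B)        ≈⟨ +-congˡ (trans (*-congˡ (-‿inverseʳ _)) (zeroʳ B)) ⟩
        B + 0#                         ≈⟨ +-identityʳ B ⟩
        B                              ≈⟨ B-eq ⟩
        1# + t * (B′ * B)              ≈⟨ +-congˡ (*-congˡ (*-congʳ
          (trans B′-eq (+-congˡ (*-congˡ (E-closed D ℕ.≤-refl)))))) ⟩
        1# + t * ((B + y * ((t * B) ^ D * (t ^ k * (B - 1#)))) * B)
          ≈⟨ solve 6 (λ t B y T tᵏ C →
               con 1 :+ t :* ((B :+ y :* (T :* (tᵏ :* C))) :* B)
            := con 1 :+ tᵏ :* (t :* B :* T) :* y :* C :+ t :* B :* B)
               ≈-refl t B y ((t * B) ^ D) (t ^ k) (B - 1#) ⟩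
        1# + t ^ k * (t * B) ^ suc D * y * (B - 1#) + t * B * B
          ≈⟨ +-congʳ (+-congˡ (*-congʳ (*-congʳ powers))) ⟩
        1# + t ^ (suc k ℕ.+ D) * B ^ suc D * y * (B - 1#) + t * B * B  ∎

-- Binary trees and their enumeration by size.

data Tree : Set where
  leaf : Tree
  node : Tree → Tree → Tree

size : Tree → ℕ
size leaf       = 0
size (node l r) = suc (size l ℕ.+ size r)

-- d bounds the depth; it serves only to make the recursion structural.

treesOfDepth≤ : ℕ → ℕ → List Tree
nodes : ∀ d n → Fin (suc n) → List Tree

treesOfDepth≤ d       zero    = [ leaf ]
treesOfDepth≤ zero    (suc n) = []
treesOfDepth≤ (suc d) (suc n) = concat (tabulate (nodes d n))

nodes d n i =
  cartesianProductWith node (treesOfDepth≤ d (toℕ i)) (treesOfDepth≤ d (n ℕ.∸ toℕ i))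

trees : ℕ → List Tree
trees n = treesOfDepth≤ n n

-- In `trees (suc n)` the subtrees are listed with the depth bound `n`, whereas a product of
-- generating functions involves `trees (toℕ i)`. Any bound that is at least the size yields the
-- same list.
treesOfDepth≤-stable : ∀ {c d n} → n ℕ.≤ c → n ℕ.≤ d → treesOfDepth≤ c n ≡ treesOfDepth≤ d n
treesOfDepth≤-stable {n = zero}  _ _ = refl
treesOfDepth≤-stable {suc c} {suc d} {suc n} (s≤s n≤c) (s≤s n≤d) =
  ≡.cong concat (List.tabulate-cong λ i → ≡.cong₂ (cartesianProductWith node)
    (treesOfDepth≤-stable (ℕ.≤-trans (Fin.toℕ≤pred[n] i) n≤c) (ℕ.≤-trans (Fin.toℕ≤pred[n] i) n≤d))
    (treesOfDepth≤-stable (ℕ.≤-trans (ℕ.m∸n≤m n (toℕ i)) n≤c) (ℕ.≤-trans (ℕ.m∸n≤m n (toℕ i)) n≤d)))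

∈-treesOfDepth≤⁻ : ∀ d n {t} → t ∈ treesOfDepth≤ d n → size t ≡ n
∈-treesOfDepth≤⁻ d       zero    (here refl) = refl
∈-treesOfDepth≤⁻ (suc d) (suc n) t∈
  with _ , t∈ts , ts∈ ← ∈.∈-concat⁻′ (tabulate (nodes d n)) t∈
  with i , refl ← ∈.∈-tabulate⁻ {f = nodes d n} ts∈
  with _ , _ , l∈ , r∈ , refl ← ∈.∈-cartesianProductWith⁻ node (treesOfDepth≤ d (toℕ i)) _ t∈ts
  = ≡.cong suc (≡.trans (≡.cong₂ ℕ._+_ (∈-treesOfDepth≤⁻ d (toℕ i) l∈) (∈-treesOfDepth≤⁻ d (n ℕ.∸ toℕ i) r∈))
                        (ℕ.m+[n∸m]≡n (Fin.toℕ≤pred[n] i)))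

∈-treesOfDepth≤⁺ : ∀ d t → size t ℕ.≤ d → t ∈ treesOfDepth≤ d (size t)
∈-treesOfDepth≤⁺ d       leaf       _         = here refl
∈-treesOfDepth≤⁺ (suc d) (node l r) (s≤s |t|≤d) =
  ∈.∈-concat⁺′ (∈.∈-cartesianProductWith⁺ node
    (≡.subst (λ k → l ∈ treesOfDepth≤ d k) (≡.sym toℕ-i)
      (∈-treesOfDepth≤⁺ d l (ℕ.m+n≤o⇒m≤o (size l) |t|≤d)))
    (≡.subst (λ k → r ∈ treesOfDepth≤ d k)
      (≡.sym (≡.trans (≡.cong (size l ℕ.+ size r ℕ.∸_) toℕ-i) (ℕ.m+n∸m≡n (size l) (size r))))
      (∈-treesOfDepth≤⁺ d r (ℕ.m+n≤o⇒n≤o (size l) |t|≤d))))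
    (∈.∈-tabulate⁺ {f = nodes d (size l ℕ.+ size r)} i)
  where
  |l|< = s≤s (ℕ.m≤m+n (size l) (size r))
  i = fromℕ< |l|<
  toℕ-i : toℕ i ≡ size l
  toℕ-i = Fin.toℕ-fromℕ< |l|<

node-injective : ∀ {l l′ r r′} → node l r ≡ node l′ r′ → l ≡ l′ × r ≡ r′
node-injective refl = refl , refl

treesOfDepth≤-unique : ∀ d n → Unique (treesOfDepth≤ d n)
treesOfDepth≤-unique d       zero    = [] ∷ []
treesOfDepth≤-unique zero    (suc n) = []
treesOfDepth≤-unique (suc d) (suc n) = Unique.concat⁺
  (AllP.tabulate⁺ λ i → Unique.cartesianProductWith⁺ node node-injective
    (treesOfDepth≤-unique d (toℕ i)) (treesOfDepth≤-unique d (n ℕ.∸ toℕ i)))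
  (AllPairs.tabulate⁺ {f = nodes d n} λ i≢j (t∈i , t∈j) → i≢j (disjoint t∈i t∈j))
  where
  disjoint : ∀ {i j t} → t ∈ nodes d n i → t ∈ nodes d n j → i ≡ j
  disjoint {i} {j} t∈i t∈j
    with _ , _ , l∈ , _ , refl ← ∈.∈-cartesianProductWith⁻ node (treesOfDepth≤ d (toℕ i)) _ t∈i
    with _ , _ , l∈′ , _ , refl ← ∈.∈-cartesianProductWith⁻ node (treesOfDepth≤ d (toℕ j)) _ t∈j
    = Fin.toℕ-injective
        (≡.trans (≡.sym (∈-treesOfDepth≤⁻ d (toℕ i) l∈)) (∈-treesOfDepth≤⁻ d (toℕ j) l∈′))

-- Generating functions of weights on trees.

module GeneratingFunction {c ℓ} (R : CommutativeRing c ℓ) where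

  open PowerSeriesRing R using (module S; t-*-suc; t-*-zero)
  open CommutativeRing R hiding (zero; refl)
  private module R = CommutativeRing R
  open SetoidReasoning setoid
  open import Algebra.Properties.CommutativeSemigroup +-commutativeSemigroup using (interchange)
  open import Algebra.Properties.Semiring.Sum semiring using (sum; sum-cong-≋)

  ∑ : List Carrier → Carrier
  ∑ = foldr _+_ 0#

  ∑-++ : ∀ xs ys → ∑ (xs ++ ys) ≈ ∑ xs + ∑ ys
  ∑-++ []       ys = sym (+-identityˡ _)
  ∑-++ (x ∷ xs) ys = trans (+-congˡ (∑-++ xs ys)) (sym (+-assoc _ _ _))

  ∑-↭ : ∀ {xs ys} → xs ↭ ys → ∑ xs ≈ ∑ ys
  ∑-↭ ↭.refl           = R.refl
  ∑-↭ (↭.prep x p)     = +-congˡ (∑-↭ p)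
  ∑-↭ (↭.swap {xs} {ys} x y p)   = begin
    x + (y + ∑ xs)  ≈⟨ +-assoc _ _ _ ⟨
    x + y + ∑ xs    ≈⟨ +-cong (+-comm x y) (∑-↭ p) ⟩
    y + x + ∑ ys    ≈⟨ +-assoc _ _ _ ⟩
    y + (x + ∑ ys)  ∎
  ∑-↭ (↭.trans p q)    = trans (∑-↭ p) (∑-↭ q)

  module _ {a} {A : Set a} where

    ∑-cong : ∀ {f g : A → Carrier} → (∀ x → f x ≈ g x) → ∀ xs → ∑ (map f xs) ≈ ∑ (map g xs)
    ∑-cong f≈g []       = R.refl
    ∑-cong f≈g (x ∷ xs) = +-cong (f≈g x) (∑-cong f≈g xs)

    ∑-+ : ∀ (f g : A → Carrier) xs → ∑ (map (λ x → f x + g x) xs) ≈ ∑ (map f xs) + ∑ (map g xs)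
    ∑-+ f g []       = sym (+-identityˡ _)
    ∑-+ f g (x ∷ xs) = trans (+-congˡ (∑-+ f g xs)) (interchange _ _ _ _)

    ∑-*ˡ : ∀ c (f : A → Carrier) xs → ∑ (map (λ x → c * f x) xs) ≈ c * ∑ (map f xs)
    ∑-*ˡ c f []       = sym (zeroʳ c)
    ∑-*ˡ c f (x ∷ xs) = trans (+-congˡ (∑-*ˡ c f xs)) (sym (distribˡ _ _ _))

    ∑-0# : ∀ (xs : List A) → ∑ (map (λ _ → 0#) xs) ≈ 0#
    ∑-0# []       = R.refl
    ∑-0# (x ∷ xs) = trans (+-identityˡ _) (∑-0# xs)

    ∑-concat-tabulate : ∀ (f : A → Carrier) {n} (h : Fin n → List A) →
      ∑ (map f (concat (tabulate h))) ≈ sum (λ i → ∑ (map f (h i)))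
    ∑-concat-tabulate f {zero}  h = R.refl
    ∑-concat-tabulate f {suc n} h = begin
      ∑ (map f (h Fin.zero ++ rest))           ≡⟨ ≡.cong ∑ (List.map-++ f (h Fin.zero) rest) ⟩
      ∑ (map f (h Fin.zero) ++ map f rest)     ≈⟨ ∑-++ (map f (h Fin.zero)) _ ⟩
      ∑ (map f (h Fin.zero)) + ∑ (map f rest)  ≈⟨ +-congˡ (∑-concat-tabulate f (λ i → h (Fin.suc i))) ⟩
      sum (λ i → ∑ (map f (h i)))              ∎
      where rest = concat (tabulate λ i → h (Fin.suc i))

  gf : (Tree → Carrier) → S.Series
  gf f n = ∑ (map f (trees n))

  gf-cong : ∀ {f g} → (∀ t → f t ≈ g t) → gf f S.≈ gf g
  gf-cong f≈g n = ∑-cong f≈g (trees n)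

  gf-+ : ∀ f g → gf (λ t → f t + g t) S.≈ gf f S.+ gf g
  gf-+ f g n = ∑-+ f g (trees n)

  gf-*ˡ : ∀ c f → gf (λ t → c * f t) S.≈ S.const c S.* gf f
  gf-*ˡ c f n = trans (∑-*ˡ c f (trees n)) (sym (PowerSeriesRing.const-* R c (gf f) n))

  -- As a right factor of `_⊛_` this weight demands an empty right subtree, that is, that the
  -- largest letter comes last.
  δ : Tree → Carrier
  δ leaf       = 1#
  δ (node l r) = 0#

  infixl 7 _⊛_
  _⊛_ : (Tree → Carrier) → (Tree → Carrier) → Tree → Carrier
  (f ⊛ g) leaf       = 0#
  (f ⊛ g) (node l r) = f l * g r

  ∑-⊛ : ∀ f g ls rs →
    ∑ (map (f ⊛ g) (cartesianProductWith node ls rs)) ≈ ∑ (map f ls) * ∑ (map g rs)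
  ∑-⊛ f g []       rs = sym (zeroˡ _)
  ∑-⊛ f g (l ∷ ls) rs = begin
    ∑ (map (f ⊛ g) (map (node l) rs ++ rest))
      ≡⟨ ≡.cong ∑ (List.map-++ (f ⊛ g) (map (node l) rs) rest) ⟩
    ∑ (map (f ⊛ g) (map (node l) rs) ++ map (f ⊛ g) rest)
      ≈⟨ ∑-++ (map (f ⊛ g) (map (node l) rs)) _ ⟩
    ∑ (map (f ⊛ g) (map (node l) rs)) + ∑ (map (f ⊛ g) rest)
      ≈⟨ +-cong (reflexive (≡.cong ∑ (≡.sym (List.map-∘ rs)))) (∑-⊛ f g ls rs) ⟩
    ∑ (map (λ r → f l * g r) rs) + ∑ (map f ls) * ∑ (map g rs)
      ≈⟨ +-congʳ (∑-*ˡ (f l) g rs) ⟩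
    f l * ∑ (map g rs) + ∑ (map f ls) * ∑ (map g rs)
      ≈⟨ distribʳ _ _ _ ⟨
    (f l + ∑ (map f ls)) * ∑ (map g rs) ∎
    where rest = cartesianProductWith node ls rs

  -- Trees of size `suc n` are listed by the size of the left subtree, just as a Cauchy product is
  -- summed; the root accounts for `S.t`.
  gf-⊛ : ∀ f g → gf (f ⊛ g) S.≈ S.t S.* (gf f S.* gf g)
  gf-⊛ f g zero    = trans (+-identityʳ _) (sym (t-*-zero (gf f S.* gf g)))
  gf-⊛ f g (suc n) = begin
    ∑ (map (f ⊛ g) (trees (suc n)))
      ≈⟨ ∑-concat-tabulate (f ⊛ g) (nodes n n) ⟩
    sum {suc n} (λ i → ∑ (map (f ⊛ g) (nodes n n i)))
      ≈⟨ sum-cong-≋ {suc n} (λ i → trans (∑-⊛ f g (treesOfDepth≤ n (toℕ i)) (treesOfDepth≤ n (n ℕ.∸ toℕ i))) (*-cong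
           (reflexive (≡.cong (λ ts → ∑ (map f ts))
             (treesOfDepth≤-stable (Fin.toℕ≤pred[n] i) ℕ.≤-refl)))
           (reflexive (≡.cong (λ ts → ∑ (map g ts))
             (treesOfDepth≤-stable (ℕ.m∸n≤m n (toℕ i)) ℕ.≤-refl))))) ⟩
    (gf f S.* gf g) n
      ≈⟨ t-*-suc (gf f S.* gf g) n ⟨
    (S.t S.* (gf f S.* gf g)) (suc n) ∎

  gf-δ : gf δ S.≈ S.1#
  gf-δ zero    = +-identityʳ _
  gf-δ (suc n) = trans
    (reflexive (≡.cong ∑ (List.map-cong-local
      (All.tabulate λ {t} t∈ → δ-node t (∈-treesOfDepth≤⁻ (suc n) (suc n) t∈)))))
    (∑-0# (trees (suc n)))
    where
    δ-node : ∀ t → size t ≡ suc n → δ t ≡ 0#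
    δ-node (node l r) _ = refl

-- Occurrences of a pattern relative to the largest letter of a word.

module Occurrences where

  open import Data.Nat.Base using (_+_)
  open ≡ using (sym; trans; cong; cong₂; subst)
  open ≡-Reasoning

  private variable
    ℓ : Level
    P Q : Set ℓ

  𝟙 : Dec P → ℕ
  𝟙 P? = if does P? then 1 else 0

  𝟙-false : (P? : Dec P) → ¬ P → 𝟙 P? ≡ 0
  𝟙-false P? ¬p = cong (if_then 1 else 0) (dec-false P? ¬p)

  𝟙-cong : (P? : Dec P) (Q? : Dec Q) → (P → Q) → (Q → P) → 𝟙 P? ≡ 𝟙 Q?
  𝟙-cong (yes _)  (yes _)  _ _ = refl
  𝟙-cong (yes p)  (no ¬q)  f _ = contradiction (f p) ¬q
  𝟙-cong (no ¬p)  (yes q)  _ g = contradiction (g q) ¬p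
  𝟙-cong (no _)   (no _)   _ _ = refl

  count-∷ : ∀ {A : Set} {P : Pred A ℓ} (P? : Decidable P) x xs →
    length (filter P? (x ∷ xs)) ≡ 𝟙 (P? x) + length (filter P? xs)
  count-∷ P? x xs with does (P? x)
  ... | true  = refl
  ... | false = refl

  rank : Word → ℕ → ℕ
  rank w b = length (filter (ℕ._≤? b) w)

  length-red : ∀ w → length (red w) ≡ length w
  length-red w = List.length-map (rank w) w

  rank-< : ∀ {w b N} → N ∈ w → b < N → rank w b < length w
  rank-< {w} {b} N∈w b<N = List.filter-notAll (ℕ._≤? b) w
    (Any.map (λ { refl → ℕ.<⇒≱ b<N }) N∈w)

  rank-max : ∀ {w N} → All (_≤ N) w → rank w N ≡ length w
  rank-max ≤N = cong length (List.filter-all (ℕ._≤? _) ≤N)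

  rank-++ : ∀ u v b → rank (u ++ v) b ≡ rank u b + rank v b
  rank-++ u v b = trans (cong length (List.filter-++ (ℕ._≤? b) u v)) (List.length-++ (filter (ℕ._≤? b) u))

  rank-[N] : ∀ {a N} → a < N → rank [ N ] a ≡ 0
  rank-[N] a<N = cong length (List.filter-none (ℕ._≤? _) (ℕ.<⇒≱ a<N ∷ []))

  red-∷ʳ-max : ∀ {L N} → All (_< N) L → red (L ∷ʳ N) ≡ red L ∷ʳ suc (length L)
  red-∷ʳ-max {L} {N} L<N = begin
    map (rank (L ∷ʳ N)) (L ∷ʳ N)                     ≡⟨ List.map-++ _ L [ N ] ⟩
    map (rank (L ∷ʳ N)) L ∷ʳ rank (L ∷ʳ N) N
      ≡⟨ cong₂ _∷ʳ_ (List.map-cong-local (All.map (λ {b} b<N →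
           trans (rank-++ L [ N ] b) (trans (cong (rank L b +_) (rank-[N] b<N)) (ℕ.+-identityʳ _))) L<N))
         (trans (rank-max (AllP.∷ʳ⁺ (All.map ℕ.<⇒≤ L<N) ℕ.≤-refl)) (trans (List.length-++ L) (ℕ.+-comm (length L) 1))) ⟩
    red L ∷ʳ suc (length L)                          ∎

  red-∷-max : ∀ {N R} → All (_< N) R → red (N ∷ R) ≡ suc (length R) ∷ red R
  red-∷-max {N} {R} R<N = cong₂ _∷_
    (rank-max {w = N ∷ R} (ℕ.≤-refl ∷ All.map ℕ.<⇒≤ R<N))
    (List.map-cong-local (All.map (λ {b} b<N →
      trans (rank-++ [ N ] R b) (cong (_+ rank R b) (rank-[N] b<N))) R<N))

  red-∷ʳ-max⁻ : ∀ {L N p} → All (_< N) L → red (L ∷ʳ N) ≡ p ∷ʳ suc (length p) → red L ≡ p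
  red-∷ʳ-max⁻ {L} L<N eq = List.∷ʳ-injectiveˡ (red L) _ (trans (sym (red-∷ʳ-max L<N)) eq)

  red-∷ʳ-max⁺ : ∀ {L N p} → All (_< N) L → red L ≡ p → red (L ∷ʳ N) ≡ p ∷ʳ suc (length p)
  red-∷ʳ-max⁺ {L} L<N refl = trans (red-∷ʳ-max L<N) (cong (λ n → red L ∷ʳ suc n) (sym (length-red L)))

  -- A word with this reduction has its largest letter at the end, and no letter of `R` can be the
  -- largest after `N`.
  red-max-last : ∀ L {N R p} → All (_< N) R → red (L ++ N ∷ R) ≡ p ∷ʳ suc (length p) → R ≡ []
  red-max-last L {N} {R} {p} R<N eq with initLast R
  ... | [] = refl
  ... | R′ ∷ʳ′ z = contradiction rank-z (ℕ.<⇒≢ (rank-< (∈.∈-insert L) (proj₂ (AllP.∷ʳ⁻ R<N))))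
    where
    w = L ++ N ∷ R′ ∷ʳ z
    w-∷ʳ : w ≡ (L ++ N ∷ R′) ∷ʳ z
    w-∷ʳ = sym (List.++-assoc L (N ∷ R′) [ z ])
    rank-z : rank w z ≡ length w
    rank-z = begin
      rank w z             ≡⟨ List.∷ʳ-injectiveʳ (map (rank w) (L ++ N ∷ R′)) p (begin
        map (rank w) (L ++ N ∷ R′) ∷ʳ rank w z    ≡⟨ List.map-++ (rank w) (L ++ N ∷ R′) [ z ] ⟨
        map (rank w) ((L ++ N ∷ R′) ∷ʳ z)         ≡⟨ cong (map (rank w)) w-∷ʳ ⟨
        red w                                     ≡⟨ eq ⟩
        p ∷ʳ suc (length p)                       ∎) ⟩
      suc (length p)       ≡⟨ ℕ.+-comm 1 (length p) ⟩
      length p + 1         ≡⟨ List.length-++ p ⟨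
      length (p ∷ʳ suc (length p))  ≡⟨ cong length eq ⟨
      length (red w)       ≡⟨ length-red w ⟩
      length w             ∎

  red-max-first : ∀ {z} L {N R p} → z < N → red (z ∷ L ++ N ∷ R) ≢ suc (length p) ∷ p
  red-max-first {z} L {N} {R} {p} z<N eq = ℕ.<⇒≢ (rank-< {w} (there (∈.∈-insert L)) z<N) (begin
    rank w z                     ≡⟨ List.∷-injectiveˡ eq ⟩
    length (suc (length p) ∷ p)  ≡⟨ cong length eq ⟨
    length (red w)               ≡⟨ length-red w ⟩
    length w                     ∎)
    where w = z ∷ L ++ N ∷ R

  -- Since `red` preserves length, at most one suffix is counted: this is the indicator that the
  -- word ends in an occurrence of `p`. Written as a count over `tails`, it unfolds in step with
  -- `mch`.
  occ : Word → Word → ℕ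
  occ p σ = length (filter (λ τ → red τ ≟ʷ p) (tails σ))

  occ-∷ : ∀ p b σ → occ p (b ∷ σ) ≡ 𝟙 (red (b ∷ σ) ≟ʷ p) + occ p σ
  occ-∷ p b σ = count-∷ (λ τ → red τ ≟ʷ p) (b ∷ σ) (tails σ)

  occ-[] : ∀ p → occ p [] ≡ 𝟙 ([] ≟ʷ p)
  occ-[] p = trans (count-∷ (λ τ → red τ ≟ʷ p) [] []) (ℕ.+-identityʳ _)

  mch-∷ : ∀ p b σ → mch p (b ∷ σ) ≡ 𝟙 (red (take (length p) (b ∷ σ)) ≟ʷ p) + mch p σ
  mch-∷ p b σ = count-∷ (λ τ → red (take (length p) τ) ≟ʷ p) (b ∷ σ) (tails σ)

  ∷ʳ≢[] : ∀ {A : Set} (xs : List A) {x} → xs ∷ʳ x ≢ []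
  ∷ʳ≢[] []       ()
  ∷ʳ≢[] (_ ∷ xs) ()

  -- The nonempty suffixes on the left are those of `L`, the empty one included, with `N` appended;
  -- the empty suffix cannot match a nonempty pattern.
  occ-∷ʳ-max : ∀ p {L N} → All (_< N) L → occ (p ∷ʳ suc (length p)) (L ∷ʳ N) ≡ occ p L
  occ-∷ʳ-max p {[]}    {N} []  = begin
    occ p′ [ N ]                                 ≡⟨ occ-∷ p′ N [] ⟩
    𝟙 (red [ N ] ≟ʷ p′) + occ p′ []              ≡⟨ cong₂ _+_
      (𝟙-cong (red [ N ] ≟ʷ p′) ([] ≟ʷ p) (red-∷ʳ-max⁻ {[]} {N} []) (red-∷ʳ-max⁺ {[]} {N} []))
      (trans (occ-[] p′) (𝟙-false ([] ≟ʷ p′) (∷ʳ≢[] p ∘ sym))) ⟩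
    𝟙 ([] ≟ʷ p) + 0                              ≡⟨ trans (ℕ.+-identityʳ _) (sym (occ-[] p)) ⟩
    occ p []                                     ∎
    where p′ = p ∷ʳ suc (length p)
  occ-∷ʳ-max p {b ∷ L} {N} bL<N@(_ ∷ L<N) = begin
    occ p′ (b ∷ L ∷ʳ N)                               ≡⟨ occ-∷ p′ b (L ∷ʳ N) ⟩
    𝟙 (red (b ∷ L ∷ʳ N) ≟ʷ p′) + occ p′ (L ∷ʳ N)      ≡⟨ cong₂ _+_
      (𝟙-cong (red (b ∷ L ∷ʳ N) ≟ʷ p′) (red (b ∷ L) ≟ʷ p) (red-∷ʳ-max⁻ bL<N) (red-∷ʳ-max⁺ bL<N))
      (occ-∷ʳ-max p L<N) ⟩
    𝟙 (red (b ∷ L) ≟ʷ p) + occ p L                    ≡⟨ occ-∷ p b L ⟨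
    occ p (b ∷ L)                                     ∎
    where p′ = p ∷ʳ suc (length p)

  occ-max-inside : ∀ p L {N R} → All (_< N) R → R ≢ [] →
    occ (p ∷ʳ suc (length p)) (L ++ N ∷ R) ≡ occ (p ∷ʳ suc (length p)) R
  occ-max-inside p []      {N} {R} R<N R≢[] = trans (occ-∷ p′ N R)
    (cong (_+ occ p′ R) (𝟙-false (red (N ∷ R) ≟ʷ p′) (R≢[] ∘ red-max-last [] R<N)))
    where p′ = p ∷ʳ suc (length p)
  occ-max-inside p (b ∷ L) {N} {R} R<N R≢[] = trans (occ-∷ p′ b (L ++ N ∷ R)) (cong₂ _+_
    (𝟙-false (red (b ∷ L ++ N ∷ R) ≟ʷ p′) (R≢[] ∘ red-max-last (b ∷ L) R<N))
    (occ-max-inside p L R<N R≢[]))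
    where p′ = p ∷ʳ suc (length p)

  -- A suffix that starts in `L` contains the larger letter `N`, so its first letter is not its
  -- largest. There remain the suffix that starts at `N` and the suffixes of `R`.
  occ-max-first : ∀ p {L N R} → All (_< N) L → All (_< N) R →
    occ (suc (length p) ∷ p) (L ++ N ∷ R) ≡ 𝟙 (red R ≟ʷ p) + occ (suc (length p) ∷ p) R
  occ-max-first p {[]} {N} {R} _ R<N = trans (occ-∷ p′ N R) (cong (_+ occ p′ R)
    (𝟙-cong (red (N ∷ R) ≟ʷ p′) (red R ≟ʷ p)
      (λ eq → List.∷-injectiveʳ (trans (sym (red-∷-max R<N)) eq))
      (λ { refl → trans (red-∷-max R<N) (cong (λ n → suc n ∷ red R) (sym (length-red R))) })))
    where p′ = suc (length p) ∷ p
  occ-max-first p {b ∷ L} {N} {R} (b<N ∷ L<N) R<N = trans (occ-∷ p′ b (L ++ N ∷ R)) (cong₂ _+_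
    (𝟙-false (red (b ∷ L ++ N ∷ R) ≟ʷ p′) (red-max-first L {p = p} b<N))
    (occ-max-first p L<N R<N))
    where p′ = suc (length p) ∷ p

  take-++ˡ : ∀ {A : Set} n (xs ys : List A) → n ≤ length xs → take n (xs ++ ys) ≡ take n xs
  take-++ˡ zero    _        _  _         = refl
  take-++ˡ (suc n) (x ∷ xs) ys (s≤s n≤)  = cong (x ∷_) (take-++ˡ n xs ys n≤)

  take-++ʳ : ∀ {A : Set} (xs ys : List A) n → take (length xs + n) (xs ++ ys) ≡ xs ++ take n ys
  take-++ʳ []       ys n = refl
  take-++ʳ (x ∷ xs) ys n = cong (x ∷_) (take-++ʳ xs ys n)

  length-∷ʳ : ∀ {A : Set} (xs : List A) x → length (xs ∷ʳ x) ≡ suc (length xs)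
  length-∷ʳ xs x = trans (List.length-++ xs) (ℕ.+-comm (length xs) 1)

  module _ (p : Word) {L : Word} {N : ℕ} {R : Word} (L<N : All (_< N) L) (R<N : All (_< N) R) where

    private
      p′ = p ∷ʳ suc (length p)
      factor = red (take (length p′) (L ++ N ∷ R)) ≟ʷ p′

      red≡⇒length : ∀ w {v} → red w ≡ v → length w ≡ length v
      red≡⇒length w refl = sym (length-red w)

    -- A factor with reduction p′ contains N only as its last letter, so an occurrence
    -- starting in L ends before N or at N.

    factor-split : 𝟙 factor ≡ 𝟙 (red (take (length p′) L) ≟ʷ p′) + 𝟙 (red L ≟ʷ p)
    factor-split with length p ℕ.<? length L
    ... | yes p<L = begin
      𝟙 factor                                       ≡⟨ cong (λ w → 𝟙 (red w ≟ʷ p′)) (take-++ˡ _ L (N ∷ R)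
                                                          (subst (_≤ length L) (sym (length-∷ʳ p _)) p<L)) ⟩
      𝟙 (red (take (length p′) L) ≟ʷ p′)             ≡⟨ ℕ.+-identityʳ _ ⟨
      𝟙 (red (take (length p′) L) ≟ʷ p′) + 0
        ≡⟨ cong (𝟙 (red (take (length p′) L) ≟ʷ p′) +_)
             (𝟙-false (red L ≟ʷ p) (λ eq → ℕ.<⇒≢ p<L (sym (red≡⇒length L eq)))) ⟨
      𝟙 (red (take (length p′) L) ≟ʷ p′) + 𝟙 (red L ≟ʷ p)  ∎
    ... | no p≮L = begin
      𝟙 factor                                              ≡⟨ cong (λ w → 𝟙 (red w ≟ʷ p′)) take-≡ ⟩
      𝟙 (red (L ++ N ∷ R′) ≟ʷ p′)                           ≡⟨ 𝟙-cong (red (L ++ N ∷ R′) ≟ʷ p′) (red L ≟ʷ p) to from ⟩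
      𝟙 (red L ≟ʷ p)
        ≡⟨ cong (_+ 𝟙 (red L ≟ʷ p)) (𝟙-false (red (take (length p′) L) ≟ʷ p′) short) ⟨
      𝟙 (red (take (length p′) L) ≟ʷ p′) + 𝟙 (red L ≟ʷ p)   ∎
      where
      L≤p = ℕ.≮⇒≥ p≮L
      e   = length p ℕ.∸ length L
      R′  = take e R

      take-≡ : take (length p′) (L ++ N ∷ R) ≡ L ++ N ∷ R′
      take-≡ = trans
        (cong (λ n → take n (L ++ N ∷ R)) (begin
          length p′                    ≡⟨ length-∷ʳ p _ ⟩
          suc (length p)               ≡⟨ cong suc (ℕ.m+[n∸m]≡n L≤p) ⟨
          suc (length L + e)           ≡⟨ ℕ.+-suc (length L) e ⟨
          length L + suc e             ∎))
        (take-++ʳ L (N ∷ R) (suc e))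

      to : red (L ++ N ∷ R′) ≡ p′ → red L ≡ p
      to eq = red-∷ʳ-max⁻ L<N
        (subst (λ r → red (L ++ N ∷ r) ≡ p′) (red-max-last L {p = p} (AllP.take⁺ e R<N) eq) eq)

      from : red L ≡ p → red (L ++ N ∷ R′) ≡ p′
      from eq = subst (λ r → red (L ++ N ∷ r) ≡ p′)
        (cong (λ n → take n R) (sym (trans (cong (ℕ._∸ length L) (sym (red≡⇒length L eq))) (ℕ.n∸n≡0 (length L)))))
        (red-∷ʳ-max⁺ L<N eq)

      short : red (take (length p′) L) ≢ p′
      short eq = ℕ.<⇒≢ (s≤s L≤p) (begin
        length L                       ≡⟨ cong length (List.take-all (length p′) L
                                            (ℕ.≤-trans L≤p (subst (length p ≤_) (sym (length-∷ʳ p _)) (ℕ.n≤1+n _)))) ⟨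
        length (take (length p′) L)    ≡⟨ red≡⇒length (take (length p′) L) eq ⟩
        length p′                      ≡⟨ length-∷ʳ p _ ⟩
        suc (length p)                 ∎)

  -- As `c` is not the largest letter of the pattern, no occurrence starts at `N`; `factor-split`
  -- deals with those that start in `L`. The pattern is given as `c ∷ q ∷ʳ _` so that `take`
  -- computes past its first letter.
  mch-max : ∀ c q → c ≢ length (c ∷ q ∷ʳ suc (suc (length q))) → let p = c ∷ q; p′ = p ∷ʳ suc (length p) in
    ∀ {L N R} → All (_< N) L → All (_< N) R →
    mch p′ (L ++ N ∷ R) ≡ mch p′ L + occ p L + mch p′ R
  mch-max c q c≢ {[]} {N} {R} _ R<N =
    trans (mch-∷ p′ N R) (cong (_+ mch p′ R) (𝟙-false (red (N ∷ R′) ≟ʷ p′) λ eq → c≢ (begin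
      c                   ≡⟨ List.∷-injectiveˡ (trans (sym (red-∷-max R′<N)) eq) ⟨
      length (N ∷ R′)     ≡⟨ length-red (N ∷ R′) ⟨
      length (red (N ∷ R′)) ≡⟨ cong length eq ⟩
      length p′           ∎)))
    where
    p′ = c ∷ q ∷ʳ suc (suc (length q))
    R′ = take (length (q ∷ʳ suc (suc (length q)))) R
    R′<N : All (_< N) R′
    R′<N = AllP.take⁺ _ R<N
  mch-max c q c≢ {b ∷ L} {N} {R} bL<N@(_ ∷ L<N) R<N = begin
    mch p′ (b ∷ L ++ N ∷ R)
      ≡⟨ mch-∷ p′ b (L ++ N ∷ R) ⟩
    𝟙 (red (take (length p′) (b ∷ L ++ N ∷ R)) ≟ʷ p′) + mch p′ (L ++ N ∷ R)
      ≡⟨ cong₂ _+_ (factor-split p bL<N R<N) (mch-max c q c≢ L<N R<N) ⟩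
    (x + y) + (mch p′ L + occ p L + mch p′ R)
      ≡⟨ ℕ.+-assoc (x + y) _ _ ⟨
    ((x + y) + (mch p′ L + occ p L)) + mch p′ R
      ≡⟨ cong (_+ mch p′ R) (interchange x y (mch p′ L) (occ p L)) ⟩
    ((x + mch p′ L) + (y + occ p L)) + mch p′ R
      ≡⟨ cong₂ (λ i j → i + j + mch p′ R) (mch-∷ p′ b L) (occ-∷ p b L) ⟨
    mch p′ (b ∷ L) + occ p (b ∷ L) + mch p′ R ∎
    where
    open import Algebra.Properties.CommutativeSemigroup ℕ.+-commutativeSemigroup using (interchange)
    p  = c ∷ q
    p′ = p ∷ʳ suc (length p)
    x  = 𝟙 (red (take (length p′) (b ∷ L)) ≟ʷ p′)
    y  = 𝟙 (red (b ∷ L) ≟ʷ p)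

-- Words of trees, and the pattern statistics as recursions on trees.

module TreeWords where

  open import Data.Nat.Base using (_+_)
  open ≡ using (sym; trans; cong; cong₂; subst)
  open ≡-Reasoning
  open Occurrences

  -- The decomposition σ = L N R at the largest letter N of a 132-avoiding σ,
  -- where every letter of L exceeds every letter of R; the letters are
  -- o + 1, …, o + n.

  word : ℕ → Tree → Word
  word o leaf       = []
  word o (node l r) = word (o + size r) l ++ suc (o + size r + size l) ∷ word o r

  word-bounds : ∀ o t → All (λ b → o < b × b ≤ o + size t) (word o t)
  word-bounds o leaf       = []
  word-bounds o (node l r) = AllP.++⁺
    (All.map (λ (o< , ≤) → ℕ.≤-<-trans (ℕ.m≤m+n o (size r)) o< , ℕ.≤-trans ≤ (ℕ.≤-trans (ℕ.n≤1+n _) N≤))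
       (word-bounds (o + size r) l))
    ((s≤s (ℕ.≤-trans (ℕ.m≤m+n o (size r)) (ℕ.m≤m+n _ (size l))) , N≤)
     ∷ All.map (λ (o< , ≤) → o< , ℕ.≤-trans ≤ (ℕ.≤-trans (ℕ.m≤m+n _ (size l)) (ℕ.≤-trans (ℕ.n≤1+n _) N≤)))
       (word-bounds o r))
    where
    N≤ : suc (o + size r + size l) ≤ o + suc (size l + size r)
    N≤ = ℕ.≤-reflexive (begin
      suc (o + size r + size l)    ≡⟨ cong suc (ℕ.+-assoc o (size r) (size l)) ⟩
      suc (o + (size r + size l))  ≡⟨ cong (λ n → suc (o + n)) (ℕ.+-comm (size r) (size l)) ⟩
      suc (o + (size l + size r))  ≡⟨ ℕ.+-suc o _ ⟨
      o + suc (size l + size r)    ∎)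

  word-l<N : ∀ o l r → All (_< suc (o + size r + size l)) (word (o + size r) l)
  word-l<N o l r = All.map (λ b → s≤s (proj₂ b)) (word-bounds (o + size r) l)

  word-r<N : ∀ o l r → All (_< suc (o + size r + size l)) (word o r)
  word-r<N o l r = All.map (λ b → s≤s (ℕ.≤-trans (proj₂ b) (ℕ.m≤m+n _ (size l)))) (word-bounds o r)

  word-node≢[] : ∀ o l r → word o (node l r) ≢ []
  word-node≢[] o l r eq with word (o + size r) l | eq
  ... | []    | ()
  ... | _ ∷ _ | ()

  [1⋯]-∷ʳ : ∀ n → [1⋯ suc n ] ≡ [1⋯ n ] ∷ʳ suc n
  [1⋯]-∷ʳ n = trans (cong (map suc) (sym (List.upTo-∷ʳ n))) (List.map-++ suc (upTo n) [ n ])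

  length-[1⋯] : ∀ n → length [1⋯ n ] ≡ n
  length-[1⋯] n = trans (List.length-map suc (upTo n)) (List.length-upTo n)

  [1⋯]-≤ : ∀ n → All (_≤ n) [1⋯ n ]
  [1⋯]-≤ n = AllP.map⁺ (AllP.all-upTo n)

  filter-∷ʳ : ∀ a n → filter (λ b → ¬? (b ℕ.≟ a)) [1⋯ suc n ]
            ≡ filter (λ b → ¬? (b ℕ.≟ a)) [1⋯ n ] ++ filter (λ b → ¬? (b ℕ.≟ a)) [ suc n ]
  filter-∷ʳ a n = trans (cong (filter ≢a?) ([1⋯]-∷ʳ n)) (List.filter-++ ≢a? [1⋯ n ] [ suc n ])
    where ≢a? = λ b → ¬? (b ℕ.≟ a)

  γ-base : ∀ k → γ (suc k) (suc k) ≡ suc k ∷ [1⋯ k ]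
  γ-base k = cong (suc k ∷_) (begin
    filter ≢a? [1⋯ suc k ]                  ≡⟨ filter-∷ʳ (suc k) k ⟩
    filter ≢a? [1⋯ k ] ++ filter ≢a? [ suc k ]
      ≡⟨ cong₂ _++_ (List.filter-all ≢a? (All.map (λ b≤k b≡ → ℕ.<⇒≢ (s≤s b≤k) b≡) ([1⋯]-≤ k)))
                    (List.filter-reject ≢a? (λ ≢ → ≢ refl)) ⟩
    [1⋯ k ] ++ []                           ≡⟨ List.++-identityʳ _ ⟩
    [1⋯ k ]                                 ∎)
    where ≢a? = λ b → ¬? (b ℕ.≟ suc k)

  γ-∷ʳ : ∀ a n → a ≤ n → γ a (suc n) ≡ γ a n ∷ʳ suc n
  γ-∷ʳ a n a≤n = cong (a ∷_) (trans (filter-∷ʳ a n)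
    (cong (filter ≢a? [1⋯ n ] ++_) (List.filter-accept ≢a? (λ eq → ℕ.<⇒≢ (s≤s a≤n) (sym eq)))))
    where ≢a? = λ b → ¬? (b ℕ.≟ a)

  length-γ : ∀ k d → length (γ (suc k) (d + suc k)) ≡ d + suc k
  length-γ k zero    = trans (cong length (γ-base k)) (cong suc (length-[1⋯] k))
  length-γ k (suc d) = begin
    length (γ (suc k) (suc d + suc k))           ≡⟨ cong length (γ-∷ʳ (suc k) (d + suc k) (ℕ.m≤n+m _ d)) ⟩
    length (γ (suc k) (d + suc k) ∷ʳ _)          ≡⟨ length-∷ʳ (γ (suc k) (d + suc k)) _ ⟩
    suc (length (γ (suc k) (d + suc k)))         ≡⟨ cong suc (length-γ k d) ⟩
    suc d + suc k                                ∎

  -- Brings the pattern into the shape `p ∷ʳ suc (length p)` that the lemmas on the largest letter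
  -- expect.
  γ-suc : ∀ k d → γ (suc k) (suc d + suc k) ≡ γ (suc k) (d + suc k) ∷ʳ suc (length (γ (suc k) (d + suc k)))
  γ-suc k d = trans (γ-∷ʳ (suc k) (d + suc k) (ℕ.m≤n+m _ d))
    (cong (λ n → γ (suc k) (d + suc k) ∷ʳ suc n) (sym (length-γ k d)))

  -- The indicator of the left path with the given number of nodes: in an increasing word the
  -- largest letter is always last, so no node has a right subtree.
  increasing : ℕ → Tree → ℕ
  increasing zero    leaf                  = 1
  increasing zero    (node _ _)            = 0
  increasing (suc k) leaf                  = 0
  increasing (suc k) (node l leaf)         = increasing k l
  increasing (suc k) (node l (node _ _))   = 0

  𝟙-red-word : ∀ k o t → 𝟙 (red (word o t) ≟ʷ [1⋯ k ]) ≡ increasing k t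
  𝟙-red-word zero    o leaf = refl
  𝟙-red-word (suc k) o leaf = refl
  𝟙-red-word zero    o (node l r) = 𝟙-false (red (word o (node l r)) ≟ʷ []) λ eq →
    word-node≢[] o l r (red≡[] (word o (node l r)) eq)
    where
    red≡[] : ∀ w → red w ≡ [] → w ≡ []
    red≡[] [] _ = refl
  𝟙-red-word (suc k) o (node l leaf) = begin
    𝟙 (red σ ≟ʷ [1⋯ suc k ])               ≡⟨ cong (λ p → 𝟙 (red σ ≟ʷ p)) [1⋯suc] ⟩
    𝟙 (red σ ≟ʷ p′)                        ≡⟨ 𝟙-cong (red σ ≟ʷ p′) (red L ≟ʷ [1⋯ k ])
                                                (red-∷ʳ-max⁻ (word-l<N o l leaf)) (red-∷ʳ-max⁺ (word-l<N o l leaf)) ⟩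
    𝟙 (red L ≟ʷ [1⋯ k ])                   ≡⟨ 𝟙-red-word k (o + 0) l ⟩
    increasing k l                         ∎
    where
    L = word (o + 0) l
    σ = word o (node l leaf)
    p′ = [1⋯ k ] ∷ʳ suc (length [1⋯ k ])
    [1⋯suc] : [1⋯ suc k ] ≡ p′
    [1⋯suc] = trans ([1⋯]-∷ʳ k) (cong (λ n → [1⋯ k ] ∷ʳ suc n) (sym (length-[1⋯] k)))
  𝟙-red-word (suc k) o (node l r@(node r₁ r₂)) = 𝟙-false (red (word o (node l r)) ≟ʷ [1⋯ suc k ]) λ eq →
    word-node≢[] o r₁ r₂ (red-max-last (word (o + size r) l) (word-r<N o l r)
      (trans eq (trans ([1⋯]-∷ʳ k) (cong (λ n → [1⋯ k ] ∷ʳ suc n) (sym (length-[1⋯] k))))))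

  module Statistics (k : ℕ) where

    -- With a = k + 1, ends d concerns γ a (a + d), and matches D concerns
    -- γ a (a + D + 1).

    ends : ℕ → Tree → ℕ
    ends d       leaf                    = 0
    ends zero    (node l r)              = increasing k r + ends zero r
    ends (suc d) (node l leaf)           = ends d l
    ends (suc d) (node l r@(node _ _))   = ends (suc d) r

    matches : ℕ → Tree → ℕ
    matches D leaf       = 0
    matches D (node l r) = matches D l + ends D l + matches D r

    occ-word : ∀ d o t → occ (γ (suc k) (d + suc k)) (word o t) ≡ ends d t
    occ-word d       o leaf       = refl
    occ-word zero    o (node l r) = begin
      occ (γ (suc k) (suc k)) (word o (node l r))
        ≡⟨ cong (λ p → occ p (word o (node l r))) γ₀ ⟩
      occ (suc (length [1⋯ k ]) ∷ [1⋯ k ]) (word o (node l r))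
        ≡⟨ occ-max-first [1⋯ k ] (word-l<N o l r) (word-r<N o l r) ⟩
      𝟙 (red (word o r) ≟ʷ [1⋯ k ]) + occ (suc (length [1⋯ k ]) ∷ [1⋯ k ]) (word o r)
        ≡⟨ cong₂ _+_ (𝟙-red-word k o r) (trans (cong (λ p → occ p (word o r)) (sym γ₀)) (occ-word zero o r)) ⟩
      increasing k r + ends zero r ∎
      where
      γ₀ : γ (suc k) (suc k) ≡ suc (length [1⋯ k ]) ∷ [1⋯ k ]
      γ₀ = trans (γ-base k) (cong (λ n → suc n ∷ [1⋯ k ]) (sym (length-[1⋯] k)))
    occ-word (suc d) o (node l leaf) = begin
      occ (γ (suc k) (suc d + suc k)) (word o (node l leaf))
        ≡⟨ cong (λ p → occ p (word o (node l leaf))) (γ-suc k d) ⟩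
      occ (p ∷ʳ suc (length p)) (word o (node l leaf))
        ≡⟨ occ-∷ʳ-max p (word-l<N o l leaf) ⟩
      occ p (word (o + 0) l)
        ≡⟨ occ-word d (o + 0) l ⟩
      ends d l ∎
      where p = γ (suc k) (d + suc k)
    occ-word (suc d) o (node l r@(node r₁ r₂)) = begin
      occ (γ (suc k) (suc d + suc k)) (word o (node l r))
        ≡⟨ cong (λ p → occ p (word o (node l r))) (γ-suc k d) ⟩
      occ (p ∷ʳ suc (length p)) (word o (node l r))
        ≡⟨ occ-max-inside p (word (o + size r) l) (word-r<N o l r) (word-node≢[] o r₁ r₂) ⟩
      occ (p ∷ʳ suc (length p)) (word o r)
        ≡⟨ cong (λ p → occ p (word o r)) (γ-suc k d) ⟨
      occ (γ (suc k) (suc d + suc k)) (word o r)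
        ≡⟨ occ-word (suc d) o r ⟩
      ends (suc d) r ∎
      where p = γ (suc k) (d + suc k)

    mch-word : ∀ D o t → mch (γ (suc k) (suc D + suc k)) (word o t) ≡ matches D t
    mch-word D o leaf       = refl
    mch-word D o (node l r) = begin
      mch (γ (suc k) (suc D + suc k)) (word o (node l r))
        ≡⟨ cong (λ p → mch p (word o (node l r))) (γ-suc k D) ⟩
      mch p′ (word o (node l r))
        ≡⟨ mch-max (suc k) _ head≢ (word-l<N o l r) (word-r<N o l r) ⟩
      mch p′ (word (o + size r) l) + occ p (word (o + size r) l) + mch p′ (word o r)
        ≡⟨ cong₂ _+_ (cong₂ _+_ (ih (o + size r) l) (occ-word D (o + size r) l)) (ih o r) ⟩
      matches D (node l r) ∎
      where
      p  = γ (suc k) (D + suc k)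
      p′ = p ∷ʳ suc (length p)
      ih : ∀ o t → mch p′ (word o t) ≡ matches D t
      ih o t = trans (cong (λ p → mch p (word o t)) (sym (γ-suc k D))) (mch-word D o t)
      head≢ : suc k ≢ length p′
      head≢ eq = ℕ.<⇒≢ (s≤s (ℕ.m≤n+m (suc k) D)) (begin
        suc k               ≡⟨ eq ⟩
        length p′           ≡⟨ length-∷ʳ p _ ⟩
        suc (length p)      ≡⟨ cong suc (length-γ k D) ⟩
        suc (D + suc k)     ∎)

    increasing-size : ∀ j t → increasing j t ≢ 0 → size t ≡ j
    increasing-size zero    leaf                inc = refl
    increasing-size zero    (node _ _)          inc with () ← inc refl
    increasing-size (suc j) leaf                inc with () ← inc refl
    increasing-size (suc j) (node l leaf)       inc =
      cong suc (trans (ℕ.+-identityʳ _) (increasing-size j l inc))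
    increasing-size (suc j) (node l (node _ _)) inc with () ← inc refl

    -- The pattern has `d + suc k` letters, one more than the word.
    ends-small : ∀ d t → size t ≤ d + k → ends d t ≡ 0
    ends-small d       leaf                  _    = refl
    ends-small zero    (node l r)            |t|≤ = cong₂ _+_ inc≡0 (ends-small zero r (ℕ.<⇒≤ |r|<))
      where
      |r|< : size r < k
      |r|< = ℕ.≤-trans (s≤s (ℕ.m≤n+m (size r) (size l))) |t|≤
      inc≡0 : increasing k r ≡ 0
      inc≡0 with increasing k r in eq
      ... | zero  = refl
      ... | suc i = contradiction (increasing-size k r λ eq′ → ℕ.1+n≢0 (trans (sym eq) eq′)) (ℕ.<⇒≢ |r|<)
    ends-small (suc d) (node l leaf)         (s≤s |t|≤) = ends-small d l (ℕ.m+n≤o⇒m≤o (size l) |t|≤)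
    ends-small (suc d) (node l r@(node _ _)) (s≤s |t|≤) =
      ends-small (suc d) r (ℕ.≤-trans (ℕ.m+n≤o⇒n≤o (size l) |t|≤) (ℕ.n≤1+n _))

    matches-small : ∀ D t → size t ≤ suc D + k → matches D t ≡ 0
    matches-small D leaf       _          = refl
    matches-small D (node l r) (s≤s |t|≤) = cong₂ _+_
      (cong₂ _+_ (matches-small D l (ℕ.≤-trans |l|≤ (ℕ.n≤1+n _))) (ends-small D l |l|≤))
      (matches-small D r (ℕ.≤-trans (ℕ.m+n≤o⇒n≤o (size l) |t|≤) (ℕ.n≤1+n _)))
      where |l|≤ = ℕ.m+n≤o⇒m≤o (size l) |t|≤

    increasing⇒ends≡0 : ∀ d r → increasing k r ≢ 0 → ends d r ≡ 0
    increasing⇒ends≡0 d r inc = ends-small d r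
      (subst (_≤ d + k) (sym (increasing-size k r inc)) (ℕ.m≤n+m k d))

    increasing⇒matches≡0 : ∀ D r → increasing k r ≢ 0 → matches D r ≡ 0
    increasing⇒matches≡0 D r inc = matches-small D r
      (subst (_≤ suc D + k) (sym (increasing-size k r inc)) (ℕ.m≤n+m k (suc D)))

    increasing-0-1 : ∀ j t → increasing j t ≡ 0 ⊎ increasing j t ≡ 1
    increasing-0-1 zero    leaf                = inj₂ refl
    increasing-0-1 zero    (node _ _)          = inj₁ refl
    increasing-0-1 (suc j) leaf                = inj₁ refl
    increasing-0-1 (suc j) (node l leaf)       = increasing-0-1 j l
    increasing-0-1 (suc j) (node l (node _ _)) = inj₁ refl

    -- At a node the two summands exclude each other: an `r` of exactly `k` nodes is too small to
    -- end in an occurrence. This makes a power with exponent `ends` linear in `ends`.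
    ends-0-1 : ∀ d t → ends d t ≡ 0 ⊎ ends d t ≡ 1
    ends-0-1 d       leaf                  = inj₁ refl
    ends-0-1 zero    (node l r) with increasing-0-1 k r
    ... | inj₁ eq = subst (λ i → i + ends 0 r ≡ 0 ⊎ i + ends 0 r ≡ 1) (sym eq) (ends-0-1 zero r)
    ... | inj₂ eq = inj₂ (cong₂ _+_ eq (increasing⇒ends≡0 0 r λ eq′ → ℕ.1+n≢0 (trans (sym eq) eq′)))
    ends-0-1 (suc d) (node l leaf)         = ends-0-1 d l
    ends-0-1 (suc d) (node l r@(node _ _)) = ends-0-1 (suc d) r

    -- For k = 0 the word γ 1 m is increasing and may end in several γ 1 m′ at once.

    ends-exclusive : .{{ℕ.NonZero k}} → ∀ {d e} t → d < e → ends d t ≢ 0 → ends e t ≡ 0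
    ends-exclusive                   leaf                  _ _ = refl
    ends-exclusive {zero}  {suc e}   (node l leaf)         _ end = contradiction (inc≡0 k) end
      where
      inc≡0 : ∀ j → .{{ℕ.NonZero j}} → increasing j leaf + 0 ≡ 0
      inc≡0 (suc j) = refl
    ends-exclusive {zero}  {suc e}   (node l r@(node _ _)) _ end =
      [ (λ inc≡0 → ends-exclusive r (s≤s z≤n) λ ends≡0 → end (cong₂ _+_ inc≡0 ends≡0))
      , (λ inc≡1 → increasing⇒ends≡0 (suc e) r λ inc≡0 → ℕ.1+n≢0 (trans (sym inc≡1) inc≡0))
      ]′ (increasing-0-1 k r)
    ends-exclusive {suc d} {suc e}   (node l leaf)         (s≤s d<e) end = ends-exclusive l d<e end
    ends-exclusive {suc d} {suc e}   (node l r@(node _ _)) d<e       end = ends-exclusive r d<e end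

-- The bijection between trees and 132-avoiding permutations.

module Avoidance where

  open import Data.List.Membership.DecPropositional ℕ._≟_ using (_∈?_)
  open import Data.List.Relation.Unary.Unique.DecPropositional ℕ._≟_ using (unique?)
  open import Data.Nat.Base using (_+_)
  open ≡ using (sym; trans; cong; cong₂; subst)
  open ℕ.≤-Reasoning
  open Occurrences
  open TreeWords

  AllPairs-++⁻ : ∀ {A : Set} {ℓ} {R : Rel A ℓ} xs {ys} → AllPairs R (xs ++ ys) →
    AllPairs R xs × AllPairs R ys × All (λ x → All (R x) ys) xs
  AllPairs-++⁻ []       rs = [] , rs , []
  AllPairs-++⁻ (x ∷ xs) (r ∷ rs) with rxs , rys , rxys ← AllPairs-++⁻ xs rs =
    AllP.++⁻ˡ xs r ∷ rxs , rys , AllP.++⁻ʳ xs r ∷ rxys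

  unique-length-≤ : ∀ {A : Set} {xs ys : List A} → Unique xs → All (_∈ ys) xs → length xs ≤ length ys
  unique-length-≤ []                  []              = z≤n
  unique-length-≤ {xs = x ∷ xs} (x∉ ∷ xs!) (x∈ ∷ xs⊆ys)
    with u , v , refl ← ∈.∈-∃++ x∈ = begin
      suc (length xs)              ≤⟨ s≤s (unique-length-≤ xs! (All.zipWith skip (x∉ , xs⊆ys))) ⟩
      suc (length (u ++ v))        ≡⟨ cong suc (List.length-++ u) ⟩
      suc (length u + length v)    ≡⟨ ℕ.+-suc (length u) (length v) ⟨
      length u + suc (length v)    ≡⟨ List.length-++ u ⟨
      length (u ++ x ∷ v)          ∎
    where
    skip : ∀ {y} → x ≢ y × y ∈ u ++ x ∷ v → y ∈ u ++ v
    skip (x≢y , y∈) with ∈.∈-++⁻ u y∈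
    ... | inj₁ y∈u          = ∈.∈-++⁺ˡ y∈u
    ... | inj₂ (here y≡x)   = contradiction (sym y≡x) x≢y
    ... | inj₂ (there y∈v)  = ∈.∈-++⁺ʳ u y∈v

  Within : ℕ → ℕ → Word → Set
  Within o p = All (λ b → o < b × b ≤ p)

  ∈-[1⋯]⁺ : ∀ {n b} → 0 < b → b ≤ n → b ∈ [1⋯ n ]
  ∈-[1⋯]⁺ {b = suc b} _ b<n = ∈.∈-map⁺ suc (∈.∈-upTo⁺ b<n)

  ∈-[1⋯]⁻ : ∀ {n b} → b ∈ [1⋯ n ] → 0 < b × b ≤ n
  ∈-[1⋯]⁻ b∈ with _ , i∈ , refl ← ∈.∈-map⁻ suc b∈ = s≤s z≤n , ∈.∈-upTo⁻ i∈

  pigeonhole : ∀ {o p w} → o ≤ p → Unique w → Within o p w → o + length w ≤ p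
  pigeonhole {o} {p} {w} o≤p w! w∈ = begin
    o + length w                    ≤⟨ ℕ.+-monoʳ-≤ o (unique-length-≤ w! (All.map shift w∈)) ⟩
    o + length (map (o +_) [1⋯ p ℕ.∸ o ])
      ≡⟨ cong (o +_) (trans (List.length-map (o +_) [1⋯ p ℕ.∸ o ]) (length-[1⋯] _)) ⟩
    o + (p ℕ.∸ o)                   ≡⟨ ℕ.m+[n∸m]≡n o≤p ⟩
    p                               ∎
    where
    shift : ∀ {b} → o < b × b ≤ p → b ∈ map (o +_) [1⋯ p ℕ.∸ o ]
    shift {b} (o<b , b≤p) = subst (_∈ map (o +_) [1⋯ p ℕ.∸ o ]) (ℕ.m+[n∸m]≡n (ℕ.<⇒≤ o<b))
      (∈.∈-map⁺ (o +_) (∈-[1⋯]⁺ (ℕ.m<n⇒0<n∸m o<b) (ℕ.∸-monoˡ-≤ o b≤p)))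

  132-Free : Word → Set
  132-Free σ = ∀ {a c b} → a ∷ c ∷ b ∷ [] ⊆ σ → a < b → b < c → ⊥

  132-word : Word
  132-word = 1 ∷ 3 ∷ 2 ∷ []

  rank-≤ : ∀ {x b w} → x ≤ b → rank (x ∷ w) b ≡ suc (rank w b)
  rank-≤ {b = b} x≤b = cong length (List.filter-accept (ℕ._≤? b) x≤b)

  rank-> : ∀ {x b w} → b < x → rank (x ∷ w) b ≡ rank w b
  rank-> {b = b} b<x = cong length (List.filter-reject (ℕ._≤? b) (ℕ.<⇒≱ b<x))

  rank-pos : ∀ {x b w} → rank w b ≡ 0 → x ∈ w → b < x
  rank-pos {x} {b} {y ∷ w} eq x∈ with y ℕ.≤? b
  ... | yes y≤b with () ← trans (sym (rank-≤ {w = w} y≤b)) eq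
  rank-pos {x} {b} {y ∷ w} eq (here refl) | no y≰b = ℕ.≰⇒> y≰b
  rank-pos {x} {b} {y ∷ w} eq (there x∈)  | no y≰b =
    rank-pos (trans (sym (rank-> {w = w} (ℕ.≰⇒> y≰b))) eq) x∈

  avoids⇒132-free : ∀ {σ} → Avoids 132-word σ → 132-Free σ
  avoids⇒132-free av {a} {c} {b} τ⊆σ a<b b<c =
    av (_ , τ⊆σ , cong₂ _∷_ rank-a (cong₂ _∷_ rank-c (cong₂ _∷_ rank-b refl)))
    where
    a<c = ℕ.<-trans a<b b<c
    rank-a : rank (a ∷ c ∷ b ∷ []) a ≡ 1
    rank-a = trans (rank-≤ {w = c ∷ b ∷ []} ℕ.≤-refl) (cong suc (trans (rank-> {w = b ∷ []} a<c) (rank-> {w = []} a<b)))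
    rank-c : rank (a ∷ c ∷ b ∷ []) c ≡ 3
    rank-c = rank-max (ℕ.<⇒≤ a<c ∷ ℕ.≤-refl ∷ ℕ.<⇒≤ b<c ∷ [])
    rank-b : rank (a ∷ c ∷ b ∷ []) b ≡ 2
    rank-b = trans (rank-≤ {w = c ∷ b ∷ []} (ℕ.<⇒≤ a<b))
      (cong suc (trans (rank-> {w = b ∷ []} b<c) (rank-≤ {b} {w = []} ℕ.≤-refl)))

  132-free⇒avoids : ∀ {σ} → 132-Free σ → Avoids 132-word σ
  132-free⇒avoids free ([]            , _ , ())
  132-free⇒avoids free (_ ∷ []        , _ , ())
  132-free⇒avoids free (_ ∷ _ ∷ []    , _ , ())
  132-free⇒avoids free (a ∷ c ∷ b ∷ _ ∷ _ , _ , eq) with () ← cong length eq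
  132-free⇒avoids free (a ∷ c ∷ b ∷ [] , τ⊆σ , eq) = free τ⊆σ a<b b<c
    where
    τ = a ∷ c ∷ b ∷ []
    rank-a : rank τ a ≡ 1
    rank-a = List.∷-injectiveˡ eq
    rank-b : rank τ b ≡ 2
    rank-b = List.∷-injectiveˡ (List.∷-injectiveʳ (List.∷-injectiveʳ eq))
    a<b : a < b
    -- `a` itself accounts for its rank 1, so the other letters exceed it.
    a<b = rank-pos {w = c ∷ b ∷ []} (ℕ.suc-injective (trans (sym (rank-≤ {w = c ∷ b ∷ []} ℕ.≤-refl)) rank-a))
      (there (here refl))
    b<c : b < c
    b<c with c ℕ.≤? b
    ... | no c≰b = ℕ.≰⇒> c≰b
    -- Otherwise all three letters would be at most `b`, giving it rank 3.
    ... | yes c≤b with () ← trans (sym rank-b) (rank-max (ℕ.<⇒≤ a<b ∷ c≤b ∷ ℕ.≤-refl ∷ []))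

  ⊆-++-split : ∀ {A : Set} (u : List A) {v w} → w ⊆ u ++ v → ∃₂ λ w₁ w₂ → w ≡ w₁ ++ w₂ × w₁ ⊆ u × w₂ ⊆ v
  ⊆-++-split []      s            = [] , _ , refl , [] , s
  ⊆-++-split (x ∷ u) (.x Sublist.∷ʳ s) with w₁ , w₂ , eq , s₁ , s₂ ← ⊆-++-split u s =
    w₁ , w₂ , eq , x Sublist.∷ʳ s₁ , s₂
  ⊆-++-split (x ∷ u) (refl ∷ s) with w₁ , w₂ , eq , s₁ , s₂ ← ⊆-++-split u s =
    x ∷ w₁ , w₂ , cong (x ∷_) eq , refl ∷ s₁ , s₂

  -- Consider an occurrence `a c b` that is not inside `L` or `R`. If `a` is in `L` and `b` in `R`,
  -- then b < a; otherwise `N` is in the place of `a` or `b`, although `c` must be larger.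
  132-free-node : ∀ {L N R} → All (_< N) L → All (_< N) R → (∀ {l r} → l ∈ L → r ∈ R → r < l) →
    132-Free L → 132-Free R → 132-Free (L ++ N ∷ R)
  132-free-node {L} {N} {R} L<N R<N R<L freeL freeR s a<b b<c with ⊆-++-split L s
  ... | []                 , _ , refl , _  , _ Sublist.∷ʳ s₂    = freeR s₂ a<b b<c
  ... | []                 , _ , refl , _  , refl ∷ s₂  =
    ℕ.<-asym (ℕ.<-trans a<b b<c) (All.lookup R<N (lookup s₂ (here refl)))
  ... | _ ∷ []             , _ , refl , s₁ , _ Sublist.∷ʳ s₂    =
    ℕ.<-asym a<b (R<L (lookup s₁ (here refl)) (lookup s₂ (there (here refl))))
  ... | _ ∷ []             , _ , refl , s₁ , refl ∷ s₂  =
    ℕ.<-asym a<b (R<L (lookup s₁ (here refl)) (lookup s₂ (here refl)))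
  ... | _ ∷ _ ∷ []         , _ , refl , s₁ , _ Sublist.∷ʳ s₂    =
    ℕ.<-asym a<b (R<L (lookup s₁ (here refl)) (lookup s₂ (here refl)))
  ... | _ ∷ _ ∷ []         , _ , refl , s₁ , refl ∷ s₂  =
    ℕ.<-asym b<c (All.lookup L<N (lookup s₁ (there (here refl))))
  ... | _ ∷ _ ∷ _ ∷ []     , _ , refl , s₁ , _          = freeL s₁ a<b b<c

  word-r<l : ∀ o l r {x y} → x ∈ word (o + size r) l → y ∈ word o r → y < x
  word-r<l o l r x∈ y∈ = ℕ.≤-<-trans (proj₂ (All.lookup (word-bounds o r) y∈))
    (proj₁ (All.lookup (word-bounds (o + size r) l) x∈))

  length-word : ∀ o t → length (word o t) ≡ size t
  length-word o leaf       = refl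
  length-word o (node l r) = begin-equality
    length (word (o + size r) l ++ _ ∷ word o r)           ≡⟨ List.length-++ (word (o + size r) l) ⟩
    length (word (o + size r) l) + suc (length (word o r))
      ≡⟨ cong₂ (λ i j → i + suc j) (length-word _ l) (length-word o r) ⟩
    size l + suc (size r)                                  ≡⟨ ℕ.+-suc (size l) (size r) ⟩
    suc (size l + size r)                                  ∎

  word-unique : ∀ o t → Unique (word o t)
  word-unique o leaf       = []
  word-unique o (node l r) = Unique.++⁺ (word-unique _ l)
    (All.map ℕ.>⇒≢ (word-r<N o l r) ∷ word-unique o r)
    λ { (x∈l , here refl)  → ℕ.<-irrefl refl (All.lookup (word-l<N o l r) x∈l)
      ; (x∈l , there x∈r)  → ℕ.<-irrefl refl (word-r<l o l r x∈l x∈r) }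

  word-132-free : ∀ o t → 132-Free (word o t)
  word-132-free o leaf       ()
  word-132-free o (node l r) = 132-free-node (word-l<N o l r) (word-r<N o l r) (word-r<l o l r)
    (word-132-free _ l) (word-132-free o r)

  unique-split : ∀ L {N} {R : Word} → Unique (L ++ N ∷ R) →
    Unique L × Unique R × N ∉ L × N ∉ R × (∀ {l r} → l ∈ L → r ∈ R → l ≢ r)
  unique-split L σ! with L! , (N≢R ∷ R!) , L≢ ← AllPairs-++⁻ L σ! =
    L! , R! ,
    (λ N∈L → All.lookup (All.lookup L≢ N∈L) (here refl) refl) ,
    (λ N∈R → All.lookup N≢R N∈R refl) ,
    λ l∈ r∈ → All.lookup (All.lookup L≢ l∈) (there r∈)

  ≤∧≢⇒≤-pred : ∀ o {n b} → b ≤ o + suc n → b ≢ suc (o + n) → b ≤ o + n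
  ≤∧≢⇒≤-pred o {n} {b} b≤ b≢ = ℕ.≤-pred (ℕ.≤∧≢⇒< (subst (b ≤_) (ℕ.+-suc o n) b≤) b≢)

  -- By pigeonhole the top letter `N` of the interval occurs; split there. A letter of `L` below a
  -- letter of `R` would form a 132 with `N` between them, so `L` lies above `R`, and counting
  -- distinct letters confines both to the intervals that `word` prescribes. The bound `d` makes the
  -- recursion structural.
  word-surjective : ∀ d n o σ → n ≤ d → length σ ≡ n → Unique σ → Within o (o + n) σ → 132-Free σ →
    ∃ λ t → σ ≡ word o t
  word-surjective d       zero    o []      _         _   _  _  _    = leaf , refl
  word-surjective (suc d) (suc m) o σ       (s≤s m≤d) |σ| σ! σ∈ free with suc (o + m) ∈? σ
  ... | no N∉ = contradiction (pigeonhole (ℕ.m≤m+n o m) σ! (All.tabulate below))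
                  (ℕ.<⇒≱ (ℕ.+-monoʳ-< o (subst (m <_) (sym |σ|) (ℕ.n<1+n m))))
    where
    below : ∀ {b} → b ∈ σ → o < b × b ≤ o + m
    below b∈ with o<b , b≤ ← All.lookup σ∈ b∈ =
      o<b , ≤∧≢⇒≤-pred o b≤ λ { refl → N∉ b∈ }
  ... | yes N∈
    with L , R , refl ← ∈.∈-∃++ N∈
    with refl ← ℕ.suc-injective (trans (sym |σ|) (trans (List.length-++ L) (ℕ.+-suc (length L) (length R))))
    with L! , R! , N∉L , N∉R , L≢R ← unique-split L σ!
    = node (proj₁ l) (proj₁ r) , trans
        (cong₂ (λ u N → u ++ N ∷ R) (proj₂ l) N≡)
        (cong₂ (λ n v → word (o + n) (proj₁ l) ++ suc (o + n + size (proj₁ l)) ∷ v) |R| (proj₂ r))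
    where
    n = length L + length R
    N = suc (o + n)

    below : ∀ {b} → b ∈ L ++ N ∷ R → b ≢ N → b ≤ o + n
    below b∈ b≢N = ≤∧≢⇒≤-pred o (proj₂ (All.lookup σ∈ b∈)) b≢N

    L≤ : ∀ {x} → x ∈ L → x ≤ o + n
    L≤ x∈ = below (∈.∈-++⁺ˡ x∈) λ { refl → N∉L x∈ }

    R≤ : ∀ {y} → y ∈ R → y ≤ o + n
    R≤ y∈ = below (∈.∈-++⁺ʳ L (there y∈)) λ { refl → N∉R y∈ }

    R<L : ∀ {x y} → x ∈ L → y ∈ R → y < x
    R<L x∈ y∈ with ℕ.<-cmp _ _
    ... | tri< y<x _ _ = y<x
    ... | tri≈ _ y≡x _ = contradiction (sym y≡x) (L≢R x∈ y∈)
    ... | tri> _ _ x<y = contradiction (s≤s (R≤ y∈)) (free (⊆.++⁺ (from∈ x∈) (refl ∷ from∈ y∈)) x<y)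

    -- The letters of `R` are distinct and lie strictly between `o` and `x`.
    o+|R|<L : ∀ {x} → x ∈ L → o + length R < x
    o+|R|<L {x} x∈ with All.lookup σ∈ (∈.∈-++⁺ˡ x∈)
    ... | s≤s o≤x′ , _ = s≤s (pigeonhole o≤x′ R! (All.tabulate λ y∈ →
      proj₁ (All.lookup σ∈ (∈.∈-++⁺ʳ L (there y∈))) , ℕ.≤-pred (R<L x∈ y∈)))

    o+n≡ : o + n ≡ o + length R + length L
    o+n≡ = trans (cong (o +_) (ℕ.+-comm (length L) _)) (sym (ℕ.+-assoc o _ _))

    L-within : Within (o + length R) (o + length R + length L) L
    L-within = All.tabulate λ x∈ → o+|R|<L x∈ , ℕ.≤-trans (L≤ x∈) (ℕ.≤-reflexive o+n≡)

    R-within : Within o (o + length R) R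
    R-within = All.tabulate λ {y} y∈ →
      proj₁ (All.lookup σ∈ (∈.∈-++⁺ʳ L (there y∈))) ,
      ℕ.+-cancelʳ-≤ (length L) y (o + length R) (begin
        -- Dually, the distinct letters of `L` all lie above `y` and are at most `o + n`.
        y + length L                ≤⟨ pigeonhole (R≤ y∈) L! (All.tabulate λ x∈ → R<L x∈ y∈ , L≤ x∈) ⟩
        o + n                       ≡⟨ o+n≡ ⟩
        o + length R + length L     ∎)

    l = word-surjective d (length L) (o + length R) L (ℕ.≤-trans (ℕ.m≤m+n _ _) m≤d) refl L! L-within
          λ s → free (⊆.++⁺ʳ (N ∷ R) s)
    r = word-surjective d (length R) o R (ℕ.≤-trans (ℕ.m≤n+m _ _) m≤d) refl R! R-within
          λ s → free (⊆.++⁺ˡ L (N Sublist.∷ʳ s))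

    |R| : length R ≡ size (proj₁ r)
    |R| = trans (cong length (proj₂ r)) (length-word o (proj₁ r))

    N≡ : N ≡ suc (o + length R + size (proj₁ l))
    N≡ = cong suc (trans o+n≡ (cong (o + length R +_)
      (trans (cong length (proj₂ l)) (length-word (o + length R) (proj₁ l)))))

  ++-∷-injective : ∀ L L′ {N} {R R′ : Word} → N ∉ L → N ∉ L′ → L ++ N ∷ R ≡ L′ ++ N ∷ R′ → L ≡ L′ × R ≡ R′
  ++-∷-injective []      []       _  _   refl = refl , refl
  ++-∷-injective []      (_ ∷ _)  _  N∉′ refl = contradiction (here refl) N∉′
  ++-∷-injective (_ ∷ _) []       N∉ _   refl = contradiction (here refl) N∉
  ++-∷-injective (x ∷ L) (y ∷ L′) N∉ N∉′ eq
    with refl , eq′ ← List.∷-injective eq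
    with refl , R≡ ← ++-∷-injective L L′ (N∉ ∘ there) (N∉′ ∘ there) eq′ = refl , R≡

  word-max : ∀ o l r → o + length (word o (node l r)) ≡ suc (o + size r + size l)
  word-max o l r = begin-equality
    o + length (word o (node l r))   ≡⟨ cong (o +_) (length-word o (node l r)) ⟩
    o + suc (size l + size r)        ≡⟨ ℕ.+-suc o _ ⟩
    suc (o + (size l + size r))      ≡⟨ cong (λ n → suc (o + n)) (ℕ.+-comm (size l) (size r)) ⟩
    suc (o + (size r + size l))      ≡⟨ cong suc (ℕ.+-assoc o (size r) (size l)) ⟨
    suc (o + size r + size l)        ∎

  -- Equal lengths force equal largest letters, whose only position splits both words alike; the
  -- right parts then have equal sizes, which aligns the offsets of the left parts.
  word-injective : ∀ o t t′ → word o t ≡ word o t′ → t ≡ t′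
  word-injective o leaf       leaf         _  = refl
  word-injective o leaf       (node l r)   eq = contradiction (sym eq) (word-node≢[] o l r)
  word-injective o (node l r) leaf         eq = contradiction eq (word-node≢[] o l r)
  word-injective o (node l r) (node l′ r′) eq = cong₂ node (word-injective _ l l′ L≡′) (word-injective o r r′ R≡)
    where
    N≡ : suc (o + size r + size l) ≡ suc (o + size r′ + size l′)
    N≡ = begin-equality
      suc (o + size r + size l)           ≡⟨ word-max o l r ⟨
      o + length (word o (node l r))      ≡⟨ cong (λ w → o + length w) eq ⟩
      o + length (word o (node l′ r′))    ≡⟨ word-max o l′ r′ ⟩
      suc (o + size r′ + size l′)         ∎
    parts = ++-∷-injective (word (o + size r) l) (word (o + size r′) l′)
      (λ N∈ → ℕ.<-irrefl refl (All.lookup (word-l<N o l r) N∈))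
      (λ N∈ → ℕ.<-irrefl N≡ (All.lookup (word-l<N o l′ r′) N∈))
      (trans eq (cong (λ N → word (o + size r′) l′ ++ N ∷ word o r′) (sym N≡)))
    R≡ : word o r ≡ word o r′
    R≡ = proj₂ parts
    |r|≡ : size r ≡ size r′
    |r|≡ = trans (sym (length-word o r)) (trans (cong length R≡) (length-word o r′))
    L≡′ : word (o + size r) l ≡ word (o + size r) l′
    L≡′ = trans (proj₁ parts) (cong (λ n → word (o + n) l′) (sym |r|≡))

  𝒮-unique : ∀ n → Unique (𝒮 n)
  𝒮-unique n = Unique.filter⁺ unique? (wordsOver-unique n)
    where
    wordsOver-unique : ∀ j → Unique (wordsOver [1⋯ n ] j)
    wordsOver-unique zero    = [] ∷ []
    wordsOver-unique (suc j) = Unique.cartesianProductWith⁺ _∷_ List.∷-injective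
      (Unique.map⁺ ℕ.suc-injective (Unique.upTo⁺ n)) (wordsOver-unique j)

  ∈-wordsOver⁺ : ∀ {A} σ → All (_∈ A) σ → σ ∈ wordsOver A (length σ)
  ∈-wordsOver⁺ []      []          = here refl
  ∈-wordsOver⁺ (b ∷ σ) (b∈ ∷ σ∈)   = ∈.∈-cartesianProductWith⁺ _∷_ b∈ (∈-wordsOver⁺ σ σ∈)

  ∈-wordsOver⁻ : ∀ {A} n {σ} → σ ∈ wordsOver A n → length σ ≡ n × All (_∈ A) σ
  ∈-wordsOver⁻     zero    (here refl) = refl , []
  ∈-wordsOver⁻ {A} (suc n) σ∈
    with _ , _ , b∈ , σ′∈ , refl ← ∈.∈-cartesianProductWith⁻ _∷_ A (wordsOver A n) σ∈
    with |σ′| , σ′⊆ ← ∈-wordsOver⁻ n σ′∈ = cong suc |σ′| , b∈ ∷ σ′⊆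

  -- Both lists are free of repetitions and have the same members. Their orders differ, but only a
  -- sum over them is taken.
  𝒮[132]-↭ : ∀ n → 𝒮[ 132-word ] n ↭ map (word 0) (trees n)
  𝒮[132]-↭ n = ∼bag⇒↭ (unique∧set⇒bag
    (Unique.filter⁺ (avoids? 132-word) (𝒮-unique n))
    (Unique.map⁺ (λ {t} {t′} → word-injective 0 t t′) (treesOfDepth≤-unique n n))
    (mk⇔ to from))
    where
    to : ∀ {σ} → σ ∈ 𝒮[ 132-word ] n → σ ∈ map (word 0) (trees n)
    to {σ} σ∈
      with σ∈𝒮 , avoids ← ∈.∈-filter⁻ (avoids? 132-word) {xs = 𝒮 n} σ∈
      with σ∈w , σ! ← ∈.∈-filter⁻ unique? {xs = wordsOver [1⋯ n ] n} σ∈𝒮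
      with |σ| , σ⊆ ← ∈-wordsOver⁻ n σ∈w
      with t , refl ← word-surjective n n 0 σ ℕ.≤-refl |σ| σ! (All.map ∈-[1⋯]⁻ σ⊆) (avoids⇒132-free avoids)
      with refl ← trans (sym (length-word 0 t)) |σ|
      = ∈.∈-map⁺ (word 0) (∈-treesOfDepth≤⁺ n t ℕ.≤-refl)
    from : ∀ {σ} → σ ∈ map (word 0) (trees n) → σ ∈ 𝒮[ 132-word ] n
    from σ∈
      with t , t∈ , refl ← ∈.∈-map⁻ (word 0) σ∈
      with refl ← ∈-treesOfDepth≤⁻ n n t∈
      = ∈.∈-filter⁺ (avoids? 132-word)
          (∈.∈-filter⁺ unique?
            (subst (λ j → word 0 t ∈ wordsOver [1⋯ size t ] j) (length-word 0 t)
              (∈-wordsOver⁺ (word 0 t) (All.map (λ (0< , ≤) → ∈-[1⋯]⁺ 0< ≤) (word-bounds 0 t))))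
            (word-unique 0 t))
          (132-free⇒avoids (word-132-free 0 t))

-- The weights of single trees and their recursions at the root.

module TreeWeights {c ℓ} (R : CommutativeRing c ℓ) (X : CommutativeRing.Carrier R)
  (k D : ℕ) .{{_ : ℕ.NonZero k}} where

  open TreeWords.Statistics k
  open TreeWords using (increasing)
  open GeneratingFunction R
  open CommutativeRing R hiding (zero) renaming (refl to ≈-refl)
  open import Algebra.Properties.Semiring.Exp semiring using (_^_; ^-homo-*)
  open import Algebra.Properties.Semiring.Mult semiring
    using (×-homo-+; ×-congʳ; ×-comm-*) renaming (_×_ to infixr 8 _•_)
  open SetoidReasoning setoid

  -- The generating function of g is the inverse of 1 - t B.

  b b′ g : Tree → Carrier
  b  t = X ^ matches D t
  b′ t = X ^ (matches D t ℕ.+ ends D t)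
  g leaf       = 1#
  g (node l r) = b l * g r

  -- Multiplying by a 0-1 statistic selects the trees in question, so `e d` is the weight behind
  -- E_d; natural multiples turn sums of statistics into sums of weights.
  e ι : ℕ → Tree → Carrier
  e d t = ends d t • b t
  ι j t = increasing j t • 1#

  b-node : ∀ l r → b (node l r) ≈ b′ l * b r
  b-node l r = ^-homo-* X (matches D l ℕ.+ ends D l) (matches D r)

  b-eq : ∀ t → b t ≈ δ t + (b′ ⊛ b) t
  b-eq leaf       = sym (+-identityʳ _)
  b-eq (node l r) = trans (b-node l r) (sym (+-identityˡ _))

  g-eq : ∀ t → g t ≈ δ t + (b ⊛ g) t
  g-eq leaf       = sym (+-identityʳ _)
  g-eq (node l r) = sym (+-identityˡ _)

  -- For an exponent n that is 0 or 1, X^n = 1 + (X - 1) n.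
  b′-eq : ∀ t → b′ t ≈ b t + (X - 1#) * e D t
  b′-eq t = trans (^-homo-* X (matches D t) (ends D t)) (by (ends D t) (ends-0-1 D t))
    where
    u = b t
    by : ∀ n → n ≡ 0 ⊎ n ≡ 1 → u * X ^ n ≈ u + (X - 1#) * (n • u)
    by _ (inj₁ refl) = begin
      u * 1#                ≈⟨ *-identityʳ u ⟩
      u                     ≈⟨ +-identityʳ u ⟨
      u + 0#                ≈⟨ +-congˡ (zeroʳ _) ⟨
      u + (X - 1#) * 0#     ∎
    by _ (inj₂ refl) = begin
      u * (X * 1#)                    ≈⟨ trans (*-congˡ (*-identityʳ X)) (*-comm u X) ⟩
      X * u                           ≈⟨ *-congʳ X≈ ⟩
      (1# + (X - 1#)) * u             ≈⟨ distribʳ u 1# _ ⟩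
      1# * u + (X - 1#) * u           ≈⟨ +-cong (*-identityˡ u) (*-congˡ (sym (+-identityʳ u))) ⟩
      u + (X - 1#) * (u + 0#)         ∎
      where
      X≈ : X ≈ 1# + (X - 1#)
      X≈ = begin
        X                   ≈⟨ +-identityʳ X ⟨
        X + 0#              ≈⟨ +-congˡ (-‿inverseˡ 1#) ⟨
        X + (- 1# + 1#)     ≈⟨ +-assoc _ _ _ ⟨
        X - 1# + 1#         ≈⟨ +-comm _ _ ⟩
        1# + (X - 1#)       ∎

  ×-b-node : ∀ n l r → n • b (node l r) ≈ b′ l * (n • b r)
  ×-b-node n l r = trans (×-congʳ n (b-node l r)) (sym (×-comm-* n (b′ l) (b r)))

  e₀-eq : ∀ t → e 0 t ≈ (b′ ⊛ ι k) t + (b′ ⊛ e 0) t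
  e₀-eq leaf       = sym (+-identityˡ 0#)
  e₀-eq (node l r) = begin
    (increasing k r ℕ.+ ends 0 r) • b (node l r)
      ≈⟨ ×-homo-+ (b (node l r)) (increasing k r) (ends 0 r) ⟩
    increasing k r • b (node l r) + ends 0 r • b (node l r)
      ≈⟨ +-cong (×-b-node (increasing k r) l r) (×-b-node (ends 0 r) l r) ⟩
    b′ l * (increasing k r • b r) + b′ l * e 0 r
      -- When `increasing k r` is nonzero, `r` is too small to contain a match, so `b r` is `X ^ 0`.
      ≈⟨ +-congʳ (*-congˡ (reflexive (inc-b (increasing k r) refl))) ⟩
    b′ l * ι k r + b′ l * e 0 r ∎
    where
    inc-b : ∀ n → increasing k r ≡ n → n • b r ≡ n • 1#
    inc-b zero    _  = refl
    inc-b (suc n) eq = ≡.cong (λ i → suc n • X ^ i)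
      (increasing⇒matches≡0 D r λ eq′ → ℕ.1+n≢0 (≡.trans (≡.sym eq) eq′))

  e₊-eq : ∀ d → d ℕ.< D → ∀ t → e (suc d) t ≈ (e d ⊛ δ) t + (b′ ⊛ e (suc d)) t
  e₊-eq d d<D leaf            = sym (+-identityˡ 0#)
  e₊-eq d d<D (node l leaf)   = begin
    ends d l • X ^ (matches D l ℕ.+ ends D l ℕ.+ 0)
      ≡⟨ ≡.cong (λ i → ends d l • X ^ i) (ℕ.+-identityʳ (matches D l ℕ.+ ends D l)) ⟩
    ends d l • X ^ (matches D l ℕ.+ ends D l)
      -- Since `d < D`, an `l` counted by `ends d` does not end in the pattern of `ends D`, so no
      -- match is completed at the root.
      ≡⟨ e-b (ends d l) refl ⟩
    e d l                       ≈⟨ *-identityʳ _ ⟨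
    e d l * 1#                  ≈⟨ +-identityʳ _ ⟨
    e d l * 1# + 0#             ≈⟨ +-congˡ (zeroʳ _) ⟨
    e d l * 1# + b′ l * 0#      ∎
    where
    e-b : ∀ n → ends d l ≡ n → n • b′ l ≡ n • b l
    e-b zero    _  = refl
    e-b (suc n) eq = ≡.cong (λ i → suc n • X ^ i) (≡.trans
      (≡.cong (matches D l ℕ.+_) (ends-exclusive l d<D λ eq′ → ℕ.1+n≢0 (≡.trans (≡.sym eq) eq′)))
      (ℕ.+-identityʳ _))
  e₊-eq d d<D (node l r@(node _ _)) = begin
    ends (suc d) r • b (node l r)       ≈⟨ ×-b-node (ends (suc d) r) l r ⟩
    b′ l * e (suc d) r                  ≈⟨ +-identityˡ _ ⟨
    0# + b′ l * e (suc d) r             ≈⟨ +-congʳ (zeroʳ _) ⟨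
    e d l * 0# + b′ l * e (suc d) r     ∎

  ι₀-eq : ∀ t → ι 0 t ≈ δ t
  ι₀-eq leaf       = +-identityʳ 1#
  ι₀-eq (node _ _) = ≈-refl

  ι₊-eq : ∀ j t → ι (suc j) t ≈ (ι j ⊛ δ) t
  ι₊-eq j leaf                = ≈-refl
  ι₊-eq j (node l leaf)       = sym (*-identityʳ _)
  ι₊-eq j (node l (node _ _)) = sym (zeroʳ _)

-- From weights of trees to equations between series.

module TreeSeries {c ℓ} (R : CommutativeRing c ℓ) (X : CommutativeRing.Carrier R)
  (k D : ℕ) .{{_ : ℕ.NonZero k}} where

  open TreeWeights R X k D
  open GeneratingFunction R
  open PowerSeriesRing R using (module S)
  open CommutativeRing R using (_≈_; _+_; _*_; _-_; 1#; 0#; -‿inverseʳ; sym) renaming (refl to ≈-refl)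

  private
    module A = CommutativeRing (PowerSeriesRing.commutativeRing R)
    module E = KernelEquations (PowerSeriesRing.commutativeRing R)

  open SetoidReasoning A.setoid

  gf-⊛-δ : ∀ f → gf (f ⊛ δ) S.≈ S.t S.* gf f
  gf-⊛-δ f = begin
    gf (f ⊛ δ)               ≈⟨ gf-⊛ f δ ⟩
    S.t S.* (gf f S.* gf δ)  ≈⟨ A.*-congˡ {S.t} (A.*-congˡ {gf f} gf-δ) ⟩
    S.t S.* (gf f S.* S.1#)  ≈⟨ A.*-congˡ {S.t} (A.*-identityʳ (gf f)) ⟩
    S.t S.* gf f             ∎

  gf-ι : ∀ j → gf (ι j) S.≈ S.t S.^ j
  gf-ι zero    = begin
    gf (ι 0)  ≈⟨ gf-cong ι₀-eq ⟩
    gf δ      ≈⟨ gf-δ ⟩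
    S.1#      ∎
  gf-ι (suc j) = begin
    gf (ι (suc j))        ≈⟨ gf-cong (ι₊-eq j) ⟩
    gf (ι j ⊛ δ)          ≈⟨ gf-⊛-δ (ι j) ⟩
    S.t S.* gf (ι j)      ≈⟨ A.*-congˡ {S.t} (gf-ι j) ⟩
    S.t S.* S.t S.^ j     ∎

  const-X-1 : S.const (X - 1#) S.≈ S.const X S.- S.1#
  const-X-1 zero    = ≈-refl
  const-X-1 (suc n) = sym (-‿inverseʳ 0#)

  gf-sum : ∀ {f f₁ f₂ h₁ h₂} → (∀ t → f t ≈ f₁ t + f₂ t) →
    gf f₁ S.≈ h₁ → gf f₂ S.≈ h₂ → gf f S.≈ h₁ S.+ h₂
  gf-sum {f} {f₁} {f₂} {h₁} {h₂} eq eq₁ eq₂ = begin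
    gf f                          ≈⟨ gf-cong eq ⟩
    gf (λ t → f₁ t + f₂ t)        ≈⟨ gf-+ f₁ f₂ ⟩
    gf f₁ S.+ gf f₂               ≈⟨ A.+-cong {gf f₁} {h₁} {gf f₂} {h₂} eq₁ eq₂ ⟩
    h₁ S.+ h₂                     ∎

  open S using (_≈_/_)

  gf-b : ∀ {𝐁} → 𝐁 S.≈ gf b →
    𝐁 ≈ (S.1# S.+ S.t S.^ (suc k ℕ.+ D) S.* 𝐁 S.^ suc D S.* (S.const X S.- S.1#) S.* (𝐁 S.- S.1#))
      / (S.1# S.- S.t S.* 𝐁)
  gf-b {𝐁} 𝐁≈ = gf g , inverse ,
    E.B-closed {S.t} {y} {𝐁} {gf b′} (λ d → gf (e d)) k D B′-eq B-eq E₀-eq E₊-eq {gf g} inverse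
    where
    y = S.const X S.- S.1#

    ≈𝐁 : gf b S.≈ 𝐁
    ≈𝐁 = A.sym {𝐁} {gf b} 𝐁≈

    B′-eq : gf b′ S.≈ 𝐁 S.+ y S.* gf (e D)
    B′-eq = gf-sum {b′} {b} {λ t → (X - 1#) * e D t} {𝐁} {y S.* gf (e D)} b′-eq ≈𝐁 (begin
      gf (λ t → (X - 1#) * e D t)         ≈⟨ gf-*ˡ (X - 1#) (e D) ⟩
      S.const (X - 1#) S.* gf (e D)       ≈⟨ A.*-congʳ {gf (e D)} {S.const (X - 1#)} {y} const-X-1 ⟩
      y S.* gf (e D)                      ∎)

    B-eq : 𝐁 S.≈ S.1# S.+ S.t S.* (gf b′ S.* 𝐁)
    B-eq = begin
      𝐁                                     ≈⟨ 𝐁≈ ⟩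
      gf b
        ≈⟨ gf-sum {b} {δ} {b′ ⊛ b} {S.1#} {S.t S.* (gf b′ S.* gf b)} b-eq gf-δ (gf-⊛ b′ b) ⟩
      S.1# S.+ S.t S.* (gf b′ S.* gf b)     ≈⟨ A.+-congˡ {S.1#} (A.*-congˡ {S.t} (A.*-congˡ {gf b′} ≈𝐁)) ⟩
      S.1# S.+ S.t S.* (gf b′ S.* 𝐁)        ∎

    E₀-eq : gf (e 0) S.≈ S.t S.* (gf b′ S.* S.t S.^ k) S.+ S.t S.* (gf b′ S.* gf (e 0))
    E₀-eq = gf-sum {e 0} {b′ ⊛ ι k} {b′ ⊛ e 0}
      {S.t S.* (gf b′ S.* S.t S.^ k)} {S.t S.* (gf b′ S.* gf (e 0))} e₀-eq (begin
      gf (b′ ⊛ ι k)                     ≈⟨ gf-⊛ b′ (ι k) ⟩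
      S.t S.* (gf b′ S.* gf (ι k))      ≈⟨ A.*-congˡ {S.t} (A.*-congˡ {gf b′} (gf-ι k)) ⟩
      S.t S.* (gf b′ S.* S.t S.^ k)     ∎) (gf-⊛ b′ (e 0))

    E₊-eq : ∀ d → d ℕ.< D → gf (e (suc d)) S.≈ S.t S.* gf (e d) S.+ S.t S.* (gf b′ S.* gf (e (suc d)))
    E₊-eq d d<D = gf-sum {e (suc d)} {e d ⊛ δ} {b′ ⊛ e (suc d)}
      {S.t S.* gf (e d)} {S.t S.* (gf b′ S.* gf (e (suc d)))}
      (e₊-eq d d<D) (gf-⊛-δ (e d)) (gf-⊛ b′ (e (suc d)))

    inverse : (S.1# S.- S.t S.* 𝐁) S.* gf g S.≈ S.1#
    inverse = E.geometric {S.t} {𝐁} {gf g} (begin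
      gf g
        ≈⟨ gf-sum {g} {δ} {b ⊛ g} {S.1#} {S.t S.* (gf b S.* gf g)} g-eq gf-δ (gf-⊛ b g) ⟩
      S.1# S.+ S.t S.* (gf b S.* gf g)
        ≈⟨ A.+-congˡ {S.1#} (A.*-congˡ {S.t} (A.*-congʳ {gf g} {gf b} {𝐁} ≈𝐁)) ⟩
      S.1# S.+ S.t S.* (𝐁 S.* gf g)         ∎)

-- Permutations replaced by trees, and the conclusion.

-- Here `m` is one less than in the theorem. The sum is kept as a hypothesis so that matching it
-- with `refl` brings the pattern into the form that `mch-word` treats.
B-trees : ∀ k D .{{_ : ℕ.NonZero k}} {m} → D ℕ.+ suc k ≡ m → ∀ n →
  B (γ (suc k) (suc m)) n
    Polynomial.≈ GeneratingFunction.gf PolynomialRing.commutativeRing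
                   (TreeWeights.b PolynomialRing.commutativeRing Polynomial.X k D) n
B-trees k D refl n = begin
  ∑ (map weight (𝒮[ 132-word ] n))          ≈⟨ ∑-↭ (↭.map⁺ weight (𝒮[132]-↭ n)) ⟩
  ∑ (map weight (map (word 0) (trees n)))   ≡⟨ ≡.cong ∑ (List.map-∘ (trees n)) ⟨
  ∑ (map (weight ∘ word 0) (trees n))
    ≡⟨ ≡.cong ∑ (List.map-cong (λ t → ≡.cong (Polynomial.X Polynomial.^_) (mch-word D 0 t)) (trees n)) ⟩
  ∑ (map (TreeWeights.b PolynomialRing.commutativeRing Polynomial.X k D) (trees n))  ∎
  where
  open GeneratingFunction PolynomialRing.commutativeRing using (∑; ∑-↭)
  open Avoidance using (132-word; 𝒮[132]-↭)
  open TreeWords using (word; module Statistics)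
  open Statistics k using (mch-word)
  open SetoidReasoning (CommutativeRing.setoid PolynomialRing.commutativeRing)
  weight : Word → Polynomial.Poly
  weight σ = Polynomial.X Polynomial.^ mch (γ (suc k) (suc D ℕ.+ suc k)) σ

open ℚ[x]⟦t⟧ using (1#; t; x; _+_; _-_; _*_; _^_; _≈_/_)

theorem13 : (a m : ℕ) → 2 ≤ a → a ≤ m ∸ 1 →
    let 𝐁 = B (γ a m) in
    𝐁 ≈ (1# + t ^ (m ∸ 1) * 𝐁 ^ (m ∸ a) * (x - 1#) * (𝐁 - 1#)) / (1# - t * 𝐁)
theorem13 (suc zero)      _       (s≤s ()) _
theorem13 a@(suc (suc k)) (suc m) _        a≤m =
  -- `gf-b` yields the exponents `a + D` and `suc D`; as the m of the statement is `suc m` here,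
  -- they have to become `m` and `suc m ∸ a`. Its parameter for a - 1 is `suc k`, hence visibly
  -- nonzero.
  ≡.subst₂ Equation (≡.trans (ℕ.+-comm a D) D+a≡m) (≡.sym (ℕ.+-∸-assoc 1 a≤m))
    (TreeSeries.gf-b PolynomialRing.commutativeRing Polynomial.X (suc k) D {B (γ a (suc m))}
      (B-trees (suc k) D D+a≡m))
  where
  D = m ∸ a

  D+a≡m : D ℕ.+ a ≡ m
  D+a≡m = ℕ.m∸n+n≡m a≤m

  Equation : ℕ → ℕ → Set
  Equation i j = let 𝐁 = B (γ a (suc m)) in
    𝐁 ≈ (1# + t ^ i * 𝐁 ^ j * (x - 1#) * (𝐁 - 1#)) / (1# - t * 𝐁)
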